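{- Let $G$ and $H$ be graphs such that $G\times H$ is connected, and suppose neither $G$ nor $H$ is isomorphic to the path on three vertices $P_3$ or to the $4$-cycle $C_4$. Then every minimum edge-cut in $G\times H$ is of type 1, 2, 3, 4, 5, 6, 7 or 8.
   Context: The direct product $G\times H$ has vertex set $V(G)\times V(H)$, and $(x_1,y_1)$ is adjacent to $(x_2,y_2)$ if and only if $x_1x_2\in E(G)$ and $y_1y_2\in E(H)$. An edge-cut of a graph $F$ is a set $S\subseteq E(F)$ with $F-S$ disconnected; a minimum edge-cut is one of minimum size. For a minimum edge-cut $S$ of the connected graph $G\times H$, the graph $(G\times H)-S$ has exactly two connected components, denoted $B$ and $W$ (their vertex sets partition $V(G)\times V(H)$). The types are defined as follows (partitions below are of the indicated vertex sets into the listed, pairwise disjoint parts): Type 1: $B=B'\times V(H)$ and $W=W'\times V(H)$ for some partition $V(G)=B'\cup W'$. Type 2: $B=V(G)\times B''$ and $W=V(G)\times W''$ for some partition $V(H)=B''\cup W''$. Type 3: $|B|=1$ or $|W|=1$. Type 4: there are partitions $V(G)=A_1\cup A_2$ and $V(H)=C_1\cup C_2$ such that $\{B,W\}=\{(A_1\times C_1)\cup(A_2\times C_2),\ (A_1\times C_2)\cup(A_2\times C_1)\}$. Type 5: there are partitions $V(G)=A_1\cup A_2\cup A_3$ with $A_3\neq\emptyset$ and $V(H)=C_1\cup C_2$ such that one of $B,W$ equals $(A_1\times C_1)\cup(A_2\times C_2)$ and the other equals $(A_1\times C_2)\cup(A_2\times C_1)\cup(A_3\times V(H))$. Type 6: the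 same as type 5 with the roles of $G$ and $H$ interchanged, i.e. partitions $V(G)=A_1\cup A_2$ and $V(H)=C_1\cup C_2\cup C_3$ with $C_3\neq\emptyset$ such that one of $B,W$ equals $(A_1\times C_1)\cup(A_2\times C_2)$ and the other equals $(A_2\times C_1)\cup(A_1\times C_2)\cup(V(G)\times C_3)$. Type 7: there are partitions $V(G)=A_1\cup A_2\cup A_3\cup A_4$ with $A_3,A_4\neq\emptyset$ and $V(H)=C_1\cup C_2$ such that $\{B,W\}=\{(A_1\times C_1)\cup(A_2\times C_2)\cup(A_3\times V(H)),\ (A_1\times C_2)\cup(A_2\times C_1)\cup(A_4\times V(H))\}$. Type 8: the same as type 7 with the roles of $G$ and $H$ interchanged, i.e. partitions $V(G)=A_1\cup A_2$ and $V(H)=C_1\cup C_2\cup C_3\cup C_4$ with $C_3,C_4\neq\emptyset$ such that $\{B,W\}=\{(A_1\times C_1)\cup(A_2\times C_2)\cup(V(G)\times C_3),\ (A_2\times C_1)\cup(A_1\times C_2)\cup(V(G)\times C_4)\}$. -}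

module Defs where

open import Data.Nat using (ℕ; zero; suc; _+_; _≤_; _<ᵇ_)
open import Data.Fin using (Fin; zero; suc; toℕ; combine; remQuot)
open import Data.Bool using (Bool; true; false; _∧_; not; if_then_else_)
open import Data.Bool.Properties using (∧-zeroʳ)
open import Data.Product using (Σ; ∃; _×_; _,_; proj₁; proj₂)
open import Data.Sum using (_⊎_)
open import Relation.Binary.PropositionalEquality using (_≡_; refl; cong₂)
open import Relation.Nullary using (¬_)
open import Function.Bundles using (_⇔_; _↔_; Inverse)

record Graph : Set where
  field
    n      : ℕ
    adj    : Fin n → Fin n → Bool
    sym    : ∀ x y → adj x y ≡ adj y x
    irrefl : ∀ x → adj x x ≡ false
open Graph public

_≅_ : Graph → Graph → Set
G ≅ H = Σ (Fin (n G) ↔ Fin (n H)) λ f →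
          ∀ x y → adj G x y ≡ adj H (Inverse.to f x) (Inverse.to f y)

P3adj : Fin 3 → Fin 3 → Bool
P3adj zero (suc zero) = true
P3adj (suc zero) zero = true
P3adj (suc zero) (suc (suc zero)) = true
P3adj (suc (suc zero)) (suc zero) = true
P3adj _ _ = false

P3 : Graph
P3 = record { n = 3 ; adj = P3adj ; sym = s ; irrefl = i }
  where
  s : ∀ x y → P3adj x y ≡ P3adj y x
  s zero zero = refl
  s zero (suc zero) = refl
  s zero (suc (suc zero)) = refl
  s (suc zero) zero = refl
  s (suc zero) (suc zero) = refl
  s (suc zero) (suc (suc zero)) = refl
  s (suc (suc zero)) zero = refl
  s (suc (suc zero)) (suc zero) = refl
  s (suc (suc zero)) (suc (suc zero)) = refl
  i : ∀ x → P3adj x x ≡ false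
  i zero = refl
  i (suc zero) = refl
  i (suc (suc zero)) = refl

C4adj : Fin 4 → Fin 4 → Bool
C4adj zero (suc zero) = true
C4adj zero (suc (suc (suc zero))) = true
C4adj (suc zero) zero = true
C4adj (suc zero) (suc (suc zero)) = true
C4adj (suc (suc zero)) (suc zero) = true
C4adj (suc (suc zero)) (suc (suc (suc zero))) = true
C4adj (suc (suc (suc zero))) (suc (suc zero)) = true
C4adj (suc (suc (suc zero))) zero = true
C4adj _ _ = false

C4 : Graph
C4 = record { n = 4 ; adj = C4adj ; sym = s ; irrefl = i }
  where
  s : ∀ x y → C4adj x y ≡ C4adj y x
  s zero zero = refl
  s zero (suc zero) = refl
  s zero (suc (suc zero)) = refl
  s zero (suc (suc (suc zero))) = refl
  s (suc zero) zero = refl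
  s (suc zero) (suc zero) = refl
  s (suc zero) (suc (suc zero)) = refl
  s (suc zero) (suc (suc (suc zero))) = refl
  s (suc (suc zero)) zero = refl
  s (suc (suc zero)) (suc zero) = refl
  s (suc (suc zero)) (suc (suc zero)) = refl
  s (suc (suc zero)) (suc (suc (suc zero))) = refl
  s (suc (suc (suc zero))) zero = refl
  s (suc (suc (suc zero))) (suc zero) = refl
  s (suc (suc (suc zero))) (suc (suc zero)) = refl
  s (suc (suc (suc zero))) (suc (suc (suc zero))) = refl
  i : ∀ x → C4adj x x ≡ false
  i zero = refl
  i (suc zero) = refl
  i (suc (suc zero)) = refl
  i (suc (suc (suc zero))) = refl

-- Direct (tensor) product G × H.  Its vertex set Fin (n G * n H) is
-- identified with Fin (n G) × Fin (n H) via the bijection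
-- combine / remQuot from Data.Fin.

prodAdj : (G H : Graph) → Fin (n G Data.Nat.* n H) → Fin (n G Data.Nat.* n H) → Bool
prodAdj G H u v =
  adj G (proj₁ (remQuot {n G} (n H) u)) (proj₁ (remQuot {n G} (n H) v)) ∧
  adj H (proj₂ (remQuot {n G} (n H) u)) (proj₂ (remQuot {n G} (n H) v))

_⊗_ : Graph → Graph → Graph
G ⊗ H = record
  { n = n G Data.Nat.* n H
  ; adj = prodAdj G H
  ; sym = λ u v → cong₂ _∧_ (sym G _ _) (sym H _ _)
  ; irrefl = λ u → irr u
  }
  where
  irr : ∀ u → prodAdj G H u u ≡ false
  irr u rewrite irrefl G (proj₁ (remQuot {n G} (n H) u)) = refl

data Reach {N : ℕ} (A : Fin N → Fin N → Bool) : Fin N → Fin N → Set where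
  here : ∀ {u} → Reach A u u
  step : ∀ {u v w} → A u v ≡ true → Reach A v w → Reach A u w

Connected : Graph → Set
Connected F = ∀ u v → Reach (adj F) u v

record EdgeSet (F : Graph) : Set where
  field
    mem    : Fin (n F) → Fin (n F) → Bool
    memSym : ∀ u v → mem u v ≡ mem v u
    ⊆E     : ∀ u v → mem u v ≡ true → adj F u v ≡ true
open EdgeSet public

minus : (F : Graph) → EdgeSet F → Fin (n F) → Fin (n F) → Bool
minus F S u v = adj F u v ∧ not (mem S u v)

∑ : {N : ℕ} → (Fin N → ℕ) → ℕ
∑ {zero} f = 0
∑ {suc N} f = f zero + ∑ (λ i → f (suc i))

size : {F : Graph} → EdgeSet F → ℕ
size S = ∑ λ u → ∑ λ v → if (toℕ u <ᵇ toℕ v) ∧ mem S u v then 1 else 0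

IsEdgeCut : (F : Graph) → EdgeSet F → Set
IsEdgeCut F S = ¬ (∀ u v → Reach (minus F S) u v)

IsMinEdgeCut : (F : Graph) → EdgeSet F → Set
IsMinEdgeCut F S = IsEdgeCut F S × (∀ S' → IsEdgeCut F S' → size S ≤ size S')

cardT : {N : ℕ} → (Fin N → Bool) → ℕ
cardT c = ∑ λ v → if c v then 1 else 0

cardF : {N : ℕ} → (Fin N → Bool) → ℕ
cardF c = ∑ λ v → if c v then 0 else 1

-- The eight types.  A 2-colouring c of V(G × H) describes the two sides:
-- B = {v | c v ≡ true}, W = {v | c v ≡ false}.  Vertex (x,y) of G × H is
-- combine x y.  A partition of V(G) into k (possibly empty, pairwise
-- disjoint) parts A₁,…,A_k is a labelling a : Fin (n G) → Fin k, with
-- A_{i+1} = {x | a x ≡ i}.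

module _ (G H : Graph) (c : Fin (n G Data.Nat.* n H) → Bool) where

  VG = Fin (n G)
  VH = Fin (n H)

  inB : VG → VH → Set
  inB x y = c (combine x y) ≡ true

  inW : VG → VH → Set
  inW x y = c (combine x y) ≡ false

  _≐_ : (VG → VH → Set) → (VG → VH → Set) → Set
  P ≐ Q = ∀ x y → P x y ⇔ Q x y

  BW≐ : (VG → VH → Set) → (VG → VH → Set) → Set
  BW≐ X Y = (inB ≐ X × inW ≐ Y) ⊎ (inB ≐ Y × inW ≐ X)

  f0 : ∀ {k} → Fin (suc k)
  f0 = zero
  f1 : ∀ {k} → Fin (suc (suc k))
  f1 = suc zero
  f2 : ∀ {k} → Fin (suc (suc (suc k)))
  f2 = suc (suc zero)
  f3 : ∀ {k} → Fin (suc (suc (suc (suc k))))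
  f3 = suc (suc (suc zero))

  Type1 : Set
  Type1 = Σ (VG → Fin 2) λ a →
    (inB ≐ λ x y → a x ≡ f0) × (inW ≐ λ x y → a x ≡ f1)

  Type2 : Set
  Type2 = Σ (VH → Fin 2) λ γ →
    (inB ≐ λ x y → γ y ≡ f0) × (inW ≐ λ x y → γ y ≡ f1)

  Type3 : Set
  Type3 = cardT c ≡ 1 ⊎ cardF c ≡ 1

  Type4 : Set
  Type4 = Σ (VG → Fin 2) λ a → Σ (VH → Fin 2) λ γ →
    BW≐ (λ x y → (a x ≡ f0 × γ y ≡ f0) ⊎ (a x ≡ f1 × γ y ≡ f1))
        (λ x y → (a x ≡ f0 × γ y ≡ f1) ⊎ (a x ≡ f1 × γ y ≡ f0))

  Type5 : Set
  Type5 = Σ (VG → Fin 3) λ a → Σ (VH → Fin 2) λ γ →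
    (∃ λ x → a x ≡ f2) ×
    BW≐ (λ x y → (a x ≡ f0 × γ y ≡ f0) ⊎ (a x ≡ f1 × γ y ≡ f1))
        (λ x y → (a x ≡ f0 × γ y ≡ f1) ⊎ (a x ≡ f1 × γ y ≡ f0) ⊎ a x ≡ f2)

  Type6 : Set
  Type6 = Σ (VG → Fin 2) λ a → Σ (VH → Fin 3) λ γ →
    (∃ λ y → γ y ≡ f2) ×
    BW≐ (λ x y → (a x ≡ f0 × γ y ≡ f0) ⊎ (a x ≡ f1 × γ y ≡ f1))
        (λ x y → (a x ≡ f1 × γ y ≡ f0) ⊎ (a x ≡ f0 × γ y ≡ f1) ⊎ γ y ≡ f2)

  Type7 : Set
  Type7 = Σ (VG → Fin 4) λ a → Σ (VH → Fin 2) λ γ →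
    (∃ λ x → a x ≡ f2) × (∃ λ x → a x ≡ f3) ×
    BW≐ (λ x y → (a x ≡ f0 × γ y ≡ f0) ⊎ (a x ≡ f1 × γ y ≡ f1) ⊎ a x ≡ f2)
        (λ x y → (a x ≡ f0 × γ y ≡ f1) ⊎ (a x ≡ f1 × γ y ≡ f0) ⊎ a x ≡ f3)

  Type8 : Set
  Type8 = Σ (VG → Fin 2) λ a → Σ (VH → Fin 4) λ γ →
    (∃ λ y → γ y ≡ f2) × (∃ λ y → γ y ≡ f3) ×
    BW≐ (λ x y → (a x ≡ f0 × γ y ≡ f0) ⊎ (a x ≡ f1 × γ y ≡ f1) ⊎ γ y ≡ f2)
        (λ x y → (a x ≡ f1 × γ y ≡ f0) ⊎ (a x ≡ f0 × γ y ≡ f1) ⊎ γ y ≡ f3)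

  OfSomeType : Set
  OfSomeType = Type1 ⊎ Type2 ⊎ Type3 ⊎ Type4 ⊎ Type5 ⊎ Type6 ⊎ Type7 ⊎ Type8

Fin' : Graph → Graph → Set
Fin' G H = Fin (n G Data.Nat.* n H)

{-# OPTIONS --safe #-}
module Submission where

-- View the cut as a colouring c : V(G) × V(H) → {B, W}.  Types 2, 4, 6 and 8 together say that c has
-- at most two distinct rows, types 1, 4, 5 and 7 that it has at most two distinct columns.
--
-- An edge xx′ of G contributes to the cut the number κ of edges of H × K₂ cut by the rows of x and x′.
-- Let p, q be the minimum degrees of G and H; isolating a vertex shows that the cut has at most pq
-- edges.  G × H is connected, so one of the factors, say H, is not bipartite, and then κ ≥ 1 as soon
-- as one of the two rows is not constant.  Suppose that no side of the cut is a single vertex.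
--
-- * Constant and nonconstant rows cannot coexist: rows with few vertices of one colour are too
--   expensive, so an edge between the two kinds costs at least q²/2, while a set with fewer than p
--   outgoing edges has more than p vertices and so spans too many edges; compare with 2pq ≤ p² + q².
-- * If G is bipartite and no row is constant, spreading the rows of one edge over all of G shows that
--   all edges cost the same.  If two rows at distance two differ in a column y, both edges of the path
--   together cost at least deg y ≥ q.  Hence G has at most 2p edges, so G is P₃ or C₄.  Otherwise
--   rows at distance two agree, and there are only two of them.
-- * If G is not bipartite either and no row or column is constant, some edge costs less than q, which
--   forces |V(H)| ≥ 2q, and likewise |V(G)| ≥ 2p.  Then G and H already have too many edges, except
--   that equality is possible when p = q, where a parity argument rules it out.

open import Defs
open import Data.Bool using (Bool; true; false; if_then_else_; not; _∧_; _xor_) renaming (_≟_ to _≟ᵇ_)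
open import Data.Bool.Properties using (¬-not; not-¬; not-involutive; xor-comm)
open import Data.Empty using (⊥)
open import Data.Fin using (Fin; zero; suc; toℕ; combine; remQuot; _↑ˡ_; _↑ʳ_; _≟_)
open import Data.Fin.Properties using (remQuot-combine; combine-remQuot; any?; all?; injective⇒≤; toℕ-injective; toℕ<n)
open import Data.Fin.Patterns using (0F; 1F; 2F; 3F)
open import Data.Fin.Subset.Properties using (anySubset?)
open import Data.Nat using (ℕ; zero; suc; _+_; _*_; _∸_; _≤_; _<_; _<ᵇ_; _≡ᵇ_; z≤n; s≤s; >-nonZero)
open import Data.Nat.Properties hiding (_≟_)
open import Data.Nat.Tactic.RingSolver using (solve-∀)
open import Data.Product using (∃; ∃₂; _×_; _,_; proj₁; proj₂)
open import Data.Sum using (_⊎_; inj₁; inj₂; [_,_]′; swap; map)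
open import Data.Vec using (Vec; []; _∷_; lookup; tabulate)
open import Data.Vec.Properties using (lookup∘tabulate)
open import Data.Vec.Relation.Unary.All using ([]; _∷_)
open import Data.Vec.Relation.Unary.AllPairs using ([]; _∷_)
open import Data.Vec.Relation.Unary.Unique.Propositional using (Unique)
open import Data.Vec.Relation.Unary.Unique.Propositional.Properties using (lookup-injective)
open import Function using (_∘_; flip)
open import Relation.Binary.PropositionalEquality using (_≡_; _≢_; refl; cong; cong₂; subst; subst₂; trans; _≗_; module ≡-Reasoning)
import Relation.Binary.PropositionalEquality as ≡
open import Relation.Nullary using (¬_; Dec; yes; no; does; contradiction)
open import Relation.Nullary.Decidable using (_×-dec_; _→-dec_; _⊎-dec_; ¬?; decidable-stable)
open import Function.Bundles using (_⇔_; mk⇔; mk↔ₛ′; Equivalence)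

-- Finite sums

⟦_⟧ : Bool → ℕ
⟦ b ⟧ = if b then 1 else 0

⟦⟧≤1 : ∀ b → ⟦ b ⟧ ≤ 1
⟦⟧≤1 true  = ≤-refl
⟦⟧≤1 false = z≤n

∑-mono : ∀ {N} {f g : Fin N → ℕ} → (∀ i → f i ≤ g i) → ∑ f ≤ ∑ g
∑-mono {zero}  f≤g = z≤n
∑-mono {suc N} f≤g = +-mono-≤ (f≤g zero) (∑-mono (f≤g ∘ suc))

∑-cong : ∀ {N} {f g : Fin N → ℕ} → (∀ i → f i ≡ g i) → ∑ f ≡ ∑ g
∑-cong {zero}  f≡g = refl
∑-cong {suc N} f≡g = cong₂ _+_ (f≡g zero) (∑-cong (f≡g ∘ suc))

∑-mono-< : ∀ {N} {f g : Fin N → ℕ} → (∀ i → f i ≤ g i) → ∀ i → f i < g i → ∑ f < ∑ g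
∑-mono-< f≤g zero    f<g = +-mono-<-≤ f<g (∑-mono (f≤g ∘ suc))
∑-mono-< f≤g (suc i) f<g = +-mono-≤-< (f≤g zero) (∑-mono-< (f≤g ∘ suc) i f<g)

≤∑ : ∀ {N} (f : Fin N → ℕ) i → f i ≤ ∑ f
≤∑ f zero    = m≤m+n _ _
≤∑ f (suc i) = ≤-trans (≤∑ (f ∘ suc) i) (m≤n+m _ _)

∑-const : ∀ N k → ∑ {N} (λ _ → k) ≡ N * k
∑-const zero    k = refl
∑-const (suc N) k = cong (k +_) (∑-const N k)

interchange : ∀ a b c d → (a + b) + (c + d) ≡ (a + c) + (b + d)
interchange = solve-∀

∑-+ : ∀ {N} (f g : Fin N → ℕ) → ∑ (λ i → f i + g i) ≡ ∑ f + ∑ g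
∑-+ {zero}  f g = refl
∑-+ {suc N} f g = trans (cong (f zero + g zero +_) (∑-+ (f ∘ suc) (g ∘ suc)))
                        (interchange (f zero) (g zero) (∑ (f ∘ suc)) (∑ (g ∘ suc)))

∑-* : ∀ {N} k (f : Fin N → ℕ) → ∑ (λ i → k * f i) ≡ k * ∑ f
∑-* {zero}  k f = ≡.sym (*-zeroʳ k)
∑-* {suc N} k f = trans (cong (k * f zero +_) (∑-* k (f ∘ suc))) (≡.sym (*-distribˡ-+ k (f zero) _))

∑-zero : ∀ N → ∑ {N} (λ _ → 0) ≡ 0
∑-zero N = trans (∑-const N 0) (*-zeroʳ N)

∑-comm : ∀ {M N} (f : Fin M → Fin N → ℕ) → ∑ (λ i → ∑ (f i)) ≡ ∑ (λ j → ∑ (λ i → f i j))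
∑-comm {zero}  {N} f = ≡.sym (∑-zero N)
∑-comm {suc M} f = trans (cong (∑ (f zero) +_) (∑-comm (f ∘ suc))) (≡.sym (∑-+ (f zero) _))

∑-δ : ∀ {N} (j : Fin N) (f : Fin N → ℕ) → ∑ (λ i → ⟦ does (i ≟ j) ⟧ * f i) ≡ f j
∑-δ {suc N} zero    f = trans (cong₂ _+_ (*-identityˡ (f zero)) (∑-zero N)) (+-identityʳ (f zero))
∑-δ {suc N} (suc j) f = ∑-δ j (f ∘ suc)

∑-↑ : ∀ M {N} (f : Fin (M + N) → ℕ) → ∑ f ≡ ∑ (λ i → f (i ↑ˡ N)) + ∑ (λ j → f (M ↑ʳ j))
∑-↑ zero    f = refl
∑-↑ (suc M) f = trans (cong (f zero +_) (∑-↑ M (f ∘ suc))) (≡.sym (+-assoc (f zero) _ _))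

∑-combine : ∀ M {N} (f : Fin (M * N) → ℕ) → ∑ f ≡ ∑ {M} (λ i → ∑ {N} (λ j → f (combine i j)))
∑-combine zero        f = refl
∑-combine (suc M) {N} f = trans (∑-↑ N f) (cong (∑ (λ j → f (j ↑ˡ (M * N))) +_) (∑-combine M (f ∘ (N ↑ʳ_))))

weight-mono : ∀ {k l} b → (b ≡ true → k ≤ l) → ⟦ b ⟧ * k ≤ ⟦ b ⟧ * l
weight-mono true  k≤l = *-monoʳ-≤ 1 (k≤l refl)
weight-mono false k≤l = z≤n

exchange : ∀ a k b → a * (k * b) ≡ k * (a * b)
exchange = solve-∀

adj-sym : ∀ G {a b} → adj G a b ≡ true → adj G b a ≡ true
adj-sym G {a} {b} ab = trans (sym G b a) ab

adjacent⇒≢ : ∀ G {x x′} → adj G x x′ ≡ true → x ≢ x′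
adjacent⇒≢ G {x} xx refl = contradiction (trans (≡.sym xx) (irrefl G x)) λ ()

-- Sums over ordered adjacent pairs, so every edge is counted twice.

∑E : (G : Graph) → (Fin (n G) → Fin (n G) → ℕ) → ℕ
∑E G f = ∑ λ x → ∑ λ x′ → ⟦ adj G x x′ ⟧ * f x x′

deg : (G : Graph) → Fin (n G) → ℕ
deg G x = ∑ λ x′ → ⟦ adj G x x′ ⟧

vol : Graph → ℕ
vol G = ∑ (deg G)

module _ (G : Graph) where

  private
    V = Fin (n G)

  star-mono : ∀ {f g : V → ℕ} x → (∀ x′ → adj G x x′ ≡ true → f x′ ≤ g x′) →
              ∑ (λ x′ → ⟦ adj G x x′ ⟧ * f x′) ≤ ∑ (λ x′ → ⟦ adj G x x′ ⟧ * g x′)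
  star-mono x f≤g = ∑-mono (λ x′ → weight-mono (adj G x x′) (f≤g x′))

  star-mono-< : ∀ {f g : V → ℕ} x → (∀ x′ → adj G x x′ ≡ true → f x′ ≤ g x′) →
                ∀ x′ → adj G x x′ ≡ true → f x′ < g x′ →
                ∑ (λ x′ → ⟦ adj G x x′ ⟧ * f x′) < ∑ (λ x′ → ⟦ adj G x x′ ⟧ * g x′)
  star-mono-< {f} {g} x f≤g x′ xx′ f<g = ∑-mono-< (λ x′ → weight-mono (adj G x x′) (f≤g x′)) x′
    (subst (λ b → ⟦ b ⟧ * f x′ < ⟦ b ⟧ * g x′) (≡.sym xx′) (*-monoʳ-< 1 f<g))

  star-const : ∀ x k → ∑ (λ x′ → ⟦ adj G x x′ ⟧ * k) ≡ k * deg G x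
  star-const x k = trans (∑-cong (λ x′ → *-comm ⟦ adj G x x′ ⟧ k)) (∑-* k (λ x′ → ⟦ adj G x x′ ⟧))

  ∑E-mono : ∀ {f g} → (∀ x x′ → adj G x x′ ≡ true → f x x′ ≤ g x x′) → ∑E G f ≤ ∑E G g
  ∑E-mono f≤g = ∑-mono (λ x → star-mono x (f≤g x))

  ∑E-mono-< : ∀ {f g} → (∀ x x′ → adj G x x′ ≡ true → f x x′ ≤ g x x′) →
              ∀ x x′ → adj G x x′ ≡ true → f x x′ < g x x′ → ∑E G f < ∑E G g
  ∑E-mono-< f≤g x x′ xx′ f<g = ∑-mono-< (λ x → star-mono x (f≤g x)) x (star-mono-< x (f≤g x) x′ xx′ f<g)

  ∑E-cong : ∀ {f g} → (∀ x x′ → adj G x x′ ≡ true → f x x′ ≡ g x x′) → ∑E G f ≡ ∑E G g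
  ∑E-cong f≡g = ≤-antisym (∑E-mono λ x x′ xx′ → ≤-reflexive (f≡g x x′ xx′))
                          (∑E-mono λ x x′ xx′ → ≤-reflexive (≡.sym (f≡g x x′ xx′)))

  ∑E-+ : ∀ f g → ∑E G (λ x x′ → f x x′ + g x x′) ≡ ∑E G f + ∑E G g
  ∑E-+ f g = trans
    (∑-cong λ x → trans (∑-cong λ x′ → *-distribˡ-+ ⟦ adj G x x′ ⟧ (f x x′) (g x x′)) (∑-+ {n G} _ _))
    (∑-+ {n G} _ _)

  ∑E-* : ∀ k f → ∑E G (λ x x′ → k * f x x′) ≡ k * ∑E G f
  ∑E-* k f = trans
    (∑-cong λ x → trans (∑-cong λ x′ → exchange ⟦ adj G x x′ ⟧ k (f x x′)) (∑-* {n G} k _))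
    (∑-* {n G} k _)

  ∑E-flip : ∀ f → ∑E G f ≡ ∑E G (flip f)
  ∑E-flip f = trans (∑-comm {n G} {n G} _)
    (∑-cong λ x → ∑-cong λ x′ → cong (λ b → ⟦ b ⟧ * f x′ x) (sym G x′ x))

  ∑E-source : (f : V → ℕ) → ∑E G (λ x _ → f x) ≡ ∑ (λ x → f x * deg G x)
  ∑E-source f = ∑-cong {n G} λ x → star-const x (f x)

  ∑E-const : ∀ k → ∑E G (λ _ _ → k) ≡ k * vol G
  ∑E-const k = trans (∑E-source λ _ → k) (∑-* {n G} k (deg G))

  ∑E-∑-comm : ∀ {M} (f : V → V → Fin M → ℕ) →
              ∑E G (λ x x′ → ∑ (f x x′)) ≡ ∑ (λ i → ∑E G (λ x x′ → f x x′ i))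
  ∑E-∑-comm {M} f = trans
    (∑-cong {n G} λ x → trans (∑-cong {n G} λ x′ → ≡.sym (∑-* ⟦ adj G x x′ ⟧ (f x x′)))
                              (∑-comm λ x′ i → ⟦ adj G x x′ ⟧ * f x x′ i))
    (∑-comm {n G} {M} _)

  ≤∑E : ∀ f x x′ → adj G x x′ ≡ true → f x x′ ≤ ∑E G f
  ≤∑E f x x′ xx′ = begin
    f x x′                              ≡⟨ *-identityˡ _ ⟨
    1 * f x x′                          ≡⟨ cong (λ b → ⟦ b ⟧ * f x x′) xx′ ⟨
    ⟦ adj G x x′ ⟧ * f x x′             ≤⟨ ≤∑ (λ x′ → ⟦ adj G x x′ ⟧ * f x x′) x′ ⟩
    ∑ (λ x′ → ⟦ adj G x x′ ⟧ * f x x′)  ≤⟨ ≤∑ (λ x → ∑ (λ x′ → ⟦ adj G x x′ ⟧ * f x x′)) x ⟩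
    ∑E G f                              ∎
    where open ≤-Reasoning

  -- The star of x is met twice, once from either end of its edges.
  2star≤∑E : ∀ f → (∀ x x′ → f x x′ ≡ f x′ x) → ∀ x →
             2 * ∑ (λ x′ → ⟦ adj G x x′ ⟧ * f x x′) ≤ ∑E G f
  2star≤∑E f f-sym x = begin
    2 * star                                                  ≡⟨ cong (star +_) (+-identityʳ star) ⟩
    star + star                                               ≡⟨ cong₂ _+_ out in′ ⟨
    ∑E G (λ u v → δ u * f u v) + ∑E G (λ u v → δ v * f u v)   ≡⟨ ∑E-+ _ _ ⟨
    ∑E G (λ u v → δ u * f u v + δ v * f u v)                  ≤⟨ ∑E-mono once ⟩
    ∑E G f                                                    ∎
    where
    open ≤-Reasoning
    star = ∑ (λ x′ → ⟦ adj G x x′ ⟧ * f x x′)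
    δ : V → ℕ
    δ u = ⟦ does (u ≟ x) ⟧
    out : ∑E G (λ u v → δ u * f u v) ≡ star
    out = trans
      (∑-cong λ u → trans (∑-cong λ v → exchange ⟦ adj G u v ⟧ (δ u) (f u v)) (∑-* {n G} (δ u) _))
      (∑-δ x _)
    in′ : ∑E G (λ u v → δ v * f u v) ≡ star
    in′ = trans (∑E-flip _) (trans (∑E-cong λ u v _ → cong (δ u *_) (f-sym v u)) out)
    once : ∀ u v → adj G u v ≡ true → δ u * f u v + δ v * f u v ≤ f u v
    once u v uv with u ≟ x | v ≟ x
    ... | yes refl | yes refl = contradiction (trans (≡.sym uv) (irrefl G x)) λ ()
    ... | yes _    | no _     = ≤-reflexive (trans (+-identityʳ _) (+-identityʳ _))
    ... | no _     | yes _    = ≤-reflexive (+-identityʳ _)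
    ... | no _     | no _     = z≤n

∑E-comm : ∀ G H (f : Fin (n G) → Fin (n G) → Fin (n H) → Fin (n H) → ℕ) →
          ∑E G (λ x x′ → ∑E H (f x x′)) ≡ ∑E H (λ y y′ → ∑E G (λ x x′ → f x x′ y y′))
∑E-comm G H f = trans
  (∑E-∑-comm G λ x x′ y → ∑ λ y′ → ⟦ adj H y y′ ⟧ * f x x′ y y′)
  (∑-cong λ y → trans
    (∑E-∑-comm G λ x x′ y′ → ⟦ adj H y y′ ⟧ * f x x′ y y′)
    (∑-cong λ y′ → ∑E-* G ⟦ adj H y y′ ⟧ λ x x′ → f x x′ y y′))

-- Cuts of H × K₂

-- The Kronecker delta of two colours.
ind : Bool → Bool → ℕ
ind s b = ⟦ not (s xor b) ⟧

# : ∀ {N} → Bool → (Fin N → Bool) → ℕ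
# s Y = ∑ λ y → ind s (Y y)

-- The number of edges of H × K₂ cut by the colourings Y and Z of its two layers.
κ : (H : Graph) → (Fin (n H) → Bool) → (Fin (n H) → Bool) → ℕ
κ H Y Z = ∑E H λ y y′ → ⟦ Y y xor Z y′ ⟧

-- Twice the number of edges of G × H cut by c.
cost : (G H : Graph) → (Fin (n G) → Fin (n H) → Bool) → ℕ
cost G H c = ∑E G λ x x′ → κ H (c x) (c x′)

ind-refl : ∀ s → ind s s ≡ 1
ind-refl true  = refl
ind-refl false = refl

ind-not : ∀ s → ind (not s) s ≡ 0
ind-not true  = refl
ind-not false = refl

ind-complement : ∀ s b → ind (not s) b + ind s b ≡ 1
ind-complement true  true  = refl
ind-complement true  false = refl
ind-complement false true  = refl
ind-complement false false = refl

xor-ind : ∀ s a b → ⟦ a xor b ⟧ ≡ ind s a * ind (not s) b + ind (not s) a * ind s b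
xor-ind true  true  true  = refl
xor-ind true  true  false = refl
xor-ind true  false true  = refl
xor-ind true  false false = refl
xor-ind false true  true  = refl
xor-ind false true  false = refl
xor-ind false false true  = refl
xor-ind false false false = refl

xor≡true : ∀ {a b} → a ≢ b → ⟦ a xor b ⟧ ≡ 1
xor≡true {true}  {true}  a≢b = contradiction refl a≢b
xor≡true {true}  {false} a≢b = refl
xor≡true {false} {true}  a≢b = refl
xor≡true {false} {false} a≢b = contradiction refl a≢b

#-complement : ∀ {N} s (Y : Fin N → Bool) → # (not s) Y + # s Y ≡ N
#-complement {N} s Y = trans (≡.sym (∑-+ (ind (not s) ∘ Y) (ind s ∘ Y)))
  (trans (∑-cong (ind-complement s ∘ Y)) (trans (∑-const N 1) (*-identityʳ N)))

#-positive : ∀ {N} s (Y : Fin N → Bool) {y} → Y y ≡ s → 1 ≤ # s Y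
#-positive s Y {y} refl = ≤-trans (≤-reflexive (≡.sym (ind-refl s))) (≤∑ (ind s ∘ Y) y)

#-not-constant : ∀ {N} s (Y : Fin N → Bool) → (∀ y → Y y ≡ s) → # (not s) Y ≡ 0
#-not-constant {N} s Y Y≡s = trans (∑-cong λ y → trans (cong (ind (not s)) (Y≡s y)) (ind-not s)) (∑-zero N)

-- Nonconstancy is stated positively, so that it yields a vertex of any prescribed colour.
Constant NonConstant : ∀ {N} → (Fin N → Bool) → Set
Constant    Y = ∃ λ s → ∀ y → Y y ≡ s
NonConstant Y = ∀ s → ∃ λ y → Y y ≡ s

constant⊎nonConstant : ∀ {N} (Y : Fin N → Bool) → Fin N → Constant Y ⊎ NonConstant Y
constant⊎nonConstant Y y₀ with any? (λ y → Y y ≟ᵇ not (Y y₀))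
... | no ∄y        = inj₁ (Y y₀ , λ y → trans (¬-not (λ eq → ∄y (y , eq))) (not-involutive _))
... | yes (y , eq) = inj₂ hit
  where
  hit : NonConstant Y
  hit s with Y y₀ ≟ᵇ s
  ... | yes Yy₀≡s = y₀ , Yy₀≡s
  ... | no  Yy₀≢s = y , trans eq (≡.sym (¬-not (Yy₀≢s ∘ ≡.sym)))

¬constant : ∀ {N} {Y : Fin N → Bool} → NonConstant Y → ¬ Constant Y
¬constant nc (s , Y≡s) with nc (not s)
... | y , Yy = not-¬ refl (trans (≡.sym (Y≡s y)) Yy)

nonConstant? : ∀ {N} (Y : Fin N → Bool) → Fin N → Dec (NonConstant Y)
nonConstant? Y y₀ = [ (λ k → no λ nc → ¬constant nc k) , yes ]′ (constant⊎nonConstant Y y₀)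

Reach-preserves : ∀ {N} {A : Fin N → Fin N → Bool} (P : Fin N → Set) →
                  (∀ {u v} → A u v ≡ true → P u → P v) → ∀ {u v} → Reach A u v → P u → P v
Reach-preserves P closed here        Pu = Pu
Reach-preserves P closed (step uv r) Pu = Reach-preserves P closed r (closed uv Pu)

Proper : (G : Graph) → (Fin (n G) → Bool) → Set
Proper G φ = ∀ x x′ → adj G x x′ ≡ true → φ x ≢ φ x′

NonBipartite : Graph → Set
NonBipartite G = ∀ φ → ¬ Proper G φ

-- With at most two vertices, the colouring that singles out vertex 0 is injective, hence proper.
nonBipartite⇒3≤n : ∀ H → NonBipartite H → 3 ≤ n H
nonBipartite⇒3≤n H nb with 3 ≤? n H
... | yes 3≤n = 3≤n
... | no  3≰n = contradiction proper (nb λ y → toℕ y ≡ᵇ 0)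
  where
  ≤1 : ∀ (y : Fin (n H)) → toℕ y ≤ 1
  ≤1 y = ≤-pred (≤-trans (toℕ<n y) (≤-pred (≰⇒> 3≰n)))
  separates : ∀ {a b} → a ≤ 1 → b ≤ 1 → (a ≡ᵇ 0) ≡ (b ≡ᵇ 0) → a ≡ b
  separates z≤n       z≤n       _ = refl
  separates (s≤s z≤n) (s≤s z≤n) _ = refl
  proper : Proper H λ y → toℕ y ≡ᵇ 0
  proper y y′ yy′ eq with toℕ-injective (separates (≤1 y) (≤1 y′) eq)
  ... | refl = contradiction (trans (≡.sym yy′) (irrefl H y)) λ ()

-- The larger side is the bound of `κ-count` for two rows with `a` and `b` vertices of one colour.
-- Here `a < q ∸ a`. For `1 ≤ b ≤ q` this makes `b * (q ∸ a)` exceed `b * a` and the sum exceed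
-- `q * a`. For `b ≥ q` the other term is truncated to 0, but `b * (q ∸ a)` alone exceeds `q * a`.
small-side : ∀ q a b → 2 * a < q → q * a ≤ b * (q ∸ a) + a * (q ∸ b) ×
                                   (1 ≤ b → q * a < b * (q ∸ a) + a * (q ∸ b))
small-side q a zero 2a<q = ≤-reflexive (*-comm q a) , λ ()
small-side q a b@(suc _) 2a<q = <⇒≤ gain , λ _ → gain
  where
  open ≤-Reasoning
  a<q∸a : a < q ∸ a
  a<q∸a = m+n≤o⇒m≤o∸n (suc a) (≤-trans (≤-reflexive (cong (λ k → suc (a + k)) (≡.sym (+-identityʳ a)))) 2a<q)
  0<q : 0 < q
  0<q = ≤-trans (s≤s z≤n) 2a<q
  gain : q * a < b * (q ∸ a) + a * (q ∸ b)
  gain with ≤-total b q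
  ... | inj₁ b≤q = begin-strict
    q * a                      ≡⟨ cong (_* a) (m+[n∸m]≡n b≤q) ⟨
    (b + (q ∸ b)) * a          ≡⟨ *-distribʳ-+ a b (q ∸ b) ⟩
    b * a + (q ∸ b) * a        <⟨ +-mono-<-≤ (*-monoʳ-< b a<q∸a) (≤-reflexive (*-comm (q ∸ b) a)) ⟩
    b * (q ∸ a) + a * (q ∸ b)  ∎
  ... | inj₂ q≤b = begin-strict
    q * a                      <⟨ *-monoʳ-< q ⦃ >-nonZero 0<q ⦄ a<q∸a ⟩
    q * (q ∸ a)                ≤⟨ *-monoˡ-≤ (q ∸ a) q≤b ⟩
    b * (q ∸ a)                ≤⟨ m≤m+n _ _ ⟩
    b * (q ∸ a) + a * (q ∸ b)  ∎

-- For `1 ≤ a < q` the bound of `κ-count` is at least `q` whatever `b` is: it is `a * q` for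
-- `b = 0`, at least `b` for `b ≥ q`, and at least `(q ∸ a) + a` in between. So a cost below `q`
-- excludes this range of `a`.
large-side : ∀ q a b → 1 ≤ a → b * (q ∸ a) + a * (q ∸ b) < q → q ≤ a
large-side q a b 1≤a κ<q with q ≤? a
... | yes q≤a = q≤a
... | no  q≰a = contradiction κ<q (≤⇒≯ (bound b))
  where
  open ≤-Reasoning
  a<q = ≰⇒> q≰a
  1≤q∸a : 1 ≤ q ∸ a
  1≤q∸a = m<n⇒0<n∸m a<q
  bound : ∀ b → q ≤ b * (q ∸ a) + a * (q ∸ b)
  bound zero = m≤n*m q a ⦃ >-nonZero 1≤a ⦄
  bound b@(suc _) with q ≤? b
  ... | yes q≤b = begin
    q                          ≤⟨ q≤b ⟩
    b                          ≤⟨ m≤m*n b (q ∸ a) ⦃ >-nonZero 1≤q∸a ⦄ ⟩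
    b * (q ∸ a)                ≤⟨ m≤m+n _ _ ⟩
    b * (q ∸ a) + a * (q ∸ b)  ∎
  ... | no q≰b = begin
    q                          ≡⟨ m∸n+n≡m (<⇒≤ a<q) ⟨
    (q ∸ a) + a                ≤⟨ +-mono-≤ (m≤n*m (q ∸ a) b)
                                           (m≤m*n a (q ∸ b) ⦃ >-nonZero (m<n⇒0<n∸m (≰⇒> q≰b)) ⦄) ⟩
    b * (q ∸ a) + a * (q ∸ b)  ∎

module _ (H : Graph) where

  private
    Row = Fin (n H) → Bool

  κ-sym : ∀ Y Z → κ H Y Z ≡ κ H Z Y
  κ-sym Y Z = trans (∑E-flip H _) (∑E-cong H λ y y′ _ → cong ⟦_⟧ (xor-comm (Y y′) (Z y)))

  module _ (q : ℕ) (q≤deg : ∀ y → q ≤ deg H y) where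

    -- A vertex has at least `q` neighbours, of which at most `# s Z` have colour `s` in `Z`; all
    -- the others end a cut edge if the vertex has colour `s` in `Y`.
    one-side : ∀ s Y Z → # s Y * (q ∸ # s Z) ≤ ∑E H λ y y′ → ind s (Y y) * ind (not s) (Z y′)
    one-side s Y Z = begin
      # s Y * (q ∸ # s Z)                     ≡⟨ *-comm (# s Y) _ ⟩
      (q ∸ # s Z) * # s Y                     ≡⟨ ∑-* (q ∸ # s Z) (λ y → ind s (Y y)) ⟨
      ∑ (λ y → (q ∸ # s Z) * ind s (Y y))     ≤⟨ ∑-mono each ⟩
      ∑E H (λ y y′ → ind s (Y y) * ind (not s) (Z y′))  ∎
      where
      open ≤-Reasoning
      degree : ∀ y y′ → ⟦ adj H y y′ ⟧ ≤ ⟦ adj H y y′ ⟧ * ind (not s) (Z y′) + ind s (Z y′)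
      degree y y′ with adj H y y′
      ... | false = z≤n
      ... | true  = ≤-reflexive (≡.sym (trans (cong (_+ ind s (Z y′)) (+-identityʳ _)) (ind-complement s (Z y′))))
      outside : ∀ y → q ∸ # s Z ≤ ∑ λ y′ → ⟦ adj H y y′ ⟧ * ind (not s) (Z y′)
      outside y = m≤n+o⇒m∸n≤o q (# s Z) (begin
        q                                      ≤⟨ q≤deg y ⟩
        deg H y                                ≤⟨ ∑-mono (degree y) ⟩
        ∑ (λ y′ → ⟦ adj H y y′ ⟧ * ind (not s) (Z y′) + ind s (Z y′))  ≡⟨ ∑-+ {n H} _ _ ⟩
        ∑ (λ y′ → ⟦ adj H y y′ ⟧ * ind (not s) (Z y′)) + # s Z         ≡⟨ +-comm _ (# s Z) ⟩
        # s Z + ∑ (λ y′ → ⟦ adj H y y′ ⟧ * ind (not s) (Z y′))         ∎)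
      each : ∀ y → (q ∸ # s Z) * ind s (Y y) ≤ ∑ λ y′ → ⟦ adj H y y′ ⟧ * (ind s (Y y) * ind (not s) (Z y′))
      each y = begin
        (q ∸ # s Z) * ind s (Y y)                                        ≡⟨ *-comm _ (ind s (Y y)) ⟩
        ind s (Y y) * (q ∸ # s Z)                                        ≤⟨ *-monoʳ-≤ (ind s (Y y)) (outside y) ⟩
        ind s (Y y) * ∑ (λ y′ → ⟦ adj H y y′ ⟧ * ind (not s) (Z y′))     ≡⟨ ∑-* {n H} (ind s (Y y)) _ ⟨
        ∑ (λ y′ → ind s (Y y) * (⟦ adj H y y′ ⟧ * ind (not s) (Z y′)))
          ≡⟨ ∑-cong (λ y′ → exchange ⟦ adj H y y′ ⟧ (ind s (Y y)) (ind (not s) (Z y′))) ⟨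
        ∑ (λ y′ → ⟦ adj H y y′ ⟧ * (ind s (Y y) * ind (not s) (Z y′)))   ∎

    -- Cut edges are sorted by the layer in which their end has colour `s`; those of the second kind
    -- are reversed, so that both counts have the same form.
    κ-split : ∀ s Y Z → κ H Y Z ≡ ∑E H (λ y y′ → ind s (Y y) * ind (not s) (Z y′)) +
                                  ∑E H (λ y y′ → ind s (Z y) * ind (not s) (Y y′))
    κ-split s Y Z = trans (∑E-cong H λ y y′ _ → xor-ind s (Y y) (Z y′)) (trans (∑E-+ H _ _)
      (cong (∑E H (λ y y′ → ind s (Y y) * ind (not s) (Z y′)) +_)
        (trans (∑E-flip H _) (∑E-cong H λ y y′ _ → *-comm (ind (not s) (Y y′)) (ind s (Z y))))))

    κ-count : ∀ s Y Z → # s Z * (q ∸ # s Y) + # s Y * (q ∸ # s Z) ≤ κ H Y Z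
    κ-count s Y Z = ≤-trans (+-mono-≤ (one-side s Z Y) (one-side s Y Z))
      (≤-reflexive (trans (+-comm (∑E H _) _) (≡.sym (κ-split s Y Z))))

    -- This is `κ-count` for the colour that `Z` misses: one product then has a factor 0, and the
    -- other subtracts nothing.
    κ-constant : ∀ s Y Z → (∀ y → Z y ≡ s) → q * # (not s) Y ≤ κ H Y Z
    κ-constant s Y Z Z≡s = begin
      q * # (not s) Y                                      ≡⟨ *-comm q _ ⟩
      # (not s) Y * q                                      ≡⟨ cong (λ k → # (not s) Y * (q ∸ k)) (#-not-constant s Z Z≡s) ⟨
      # (not s) Y * (q ∸ # (not s) Z)                      ≤⟨ m≤n+m _ _ ⟩
      # (not s) Z * (q ∸ # (not s) Y) + # (not s) Y * (q ∸ # (not s) Z)  ≤⟨ κ-count (not s) Y Z ⟩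
      κ H Y Z                                              ∎
      where open ≤-Reasoning

  -- A free cut agrees along every edge, so whether Y and Z differ at y does not depend on y:
  -- if they agree then Y is constant, and if they differ then Y is a proper colouring.
  κ-positive : NonBipartite H → Connected H → ∀ {Y} → NonConstant Y → ∀ Z → 1 ≤ κ H Y Z
  κ-positive nb conn {Y} nc Z = n≢0⇒n>0 λ κ≡0 → free (agree κ≡0)
    where
    y₀ = proj₁ (nc true)
    agree : κ H Y Z ≡ 0 → ∀ {y y′} → adj H y y′ ≡ true → Y y ≡ Z y′
    agree κ≡0 {y} {y′} yy′ with Y y ≟ᵇ Z y′
    ... | yes eq = eq
    ... | no neq = contradiction
      (≤-trans (≤-reflexive (≡.sym (xor≡true neq))) (≤∑E H (λ y y′ → ⟦ Y y xor Z y′ ⟧) y y′ yy′))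
      (<⇒≱ (≤-reflexive (cong suc κ≡0)))
    free : (∀ {y y′} → adj H y y′ ≡ true → Y y ≡ Z y′) → ⊥
    free agree with Y y₀ ≟ᵇ Z y₀
    ... | yes eq = ¬constant nc (Y y₀ , λ y → proj₂ (everywhere y))
      where
      everywhere : ∀ y → Y y ≡ Z y × Y y ≡ Y y₀
      everywhere y = Reach-preserves (λ y → Y y ≡ Z y × Y y ≡ Y y₀)
        (λ {u} {v} uv (Yu≡Zu , Yu≡Yy₀) → let Yv≡Zu = agree (adj-sym H uv) in
          trans (trans Yv≡Zu (≡.sym Yu≡Zu)) (agree uv) , trans Yv≡Zu (trans (≡.sym Yu≡Zu) Yu≡Yy₀))
        (conn y₀ y) (eq , refl)
    ... | no neq = nb Y λ y y′ yy′ Yy≡Yy′ → everywhere y′ (trans (≡.sym Yy≡Yy′) (agree yy′))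
      where
      everywhere : ∀ y → Y y ≢ Z y
      everywhere y = Reach-preserves (λ y → Y y ≢ Z y)
        (λ {u} {v} uv Yu≢Zu Yv≡Zv → Yu≢Zu
          (trans (agree uv) (trans (≡.sym Yv≡Zv) (agree (adj-sym H uv)))))
        (conn y₀ y) neq

-- Minimum cuts without singleton sides

2*m*n≤m²+n² : ∀ m n → 2 * (m * n) ≤ m * m + n * n
2*m*n≤m²+n² m n with ≤-total m n
... | inj₁ m≤n = ordered m (n ∸ m) n (m+[n∸m]≡n m≤n)
  where
  square : ∀ m k → m * m + (m + k) * (m + k) ≡ 2 * (m * (m + k)) + k * k
  square = solve-∀
  ordered : ∀ m k n → m + k ≡ n → 2 * (m * n) ≤ m * m + n * n
  ordered m k .(m + k) refl = ≤-trans (m≤m+n _ (k * k)) (≤-reflexive (≡.sym (square m k)))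
... | inj₂ n≤m = ordered n (m ∸ n) m (m+[n∸m]≡n n≤m)
  where
  square : ∀ n k → (n + k) * (n + k) + n * n ≡ 2 * ((n + k) * n) + k * k
  square = solve-∀
  ordered : ∀ n k m → n + k ≡ m → 2 * (m * n) ≤ m * m + n * n
  ordered n k .(n + k) refl = ≤-trans (m≤m+n _ (k * k)) (≤-reflexive (≡.sym (square n k)))

-- The field mate expresses that no side of the cut is a single vertex.
record MinCut (G H : Graph) (c : Fin (n G) → Fin (n H) → Bool) : Set where
  field
    p q      : ℕ
    p≤deg    : ∀ x → p ≤ deg G x
    q≤deg    : ∀ y → q ≤ deg H y
    1≤p      : 1 ≤ p
    1≤q      : 1 ≤ q
    connG    : Connected G
    connH    : Connected H
    cost≤2pq : cost G H c ≤ 2 * (p * q)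
    mate     : ∀ x y → ∃₂ λ x′ y′ → adj G x x′ ≡ true × adj H y y′ ≡ true × c x′ y′ ≡ c x y
    minimal  : ∀ c′ {x y x′ y′} → c′ x y ≢ c′ x′ y′ → cost G H c ≤ cost G H c′

cost-transpose : ∀ G H c → cost G H c ≡ cost H G (flip c)
cost-transpose G H c = ∑E-comm G H λ x x′ y y′ → ⟦ c x y xor c x′ y′ ⟧

transpose : ∀ {G H c} → MinCut G H c → MinCut H G (flip c)
transpose {G} {H} {c} M = record
  { p = q ; q = p ; p≤deg = q≤deg ; q≤deg = p≤deg ; 1≤p = 1≤q ; 1≤q = 1≤p ; connG = connH ; connH = connG
  ; cost≤2pq = subst₂ _≤_ (cost-transpose G H c) (cong (2 *_) (*-comm p q)) cost≤2pq
  ; mate = λ y x → let (x′ , y′ , xx′ , yy′ , eq) = mate x y in y′ , x′ , yy′ , xx′ , eq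
  ; minimal = λ c′ c′≢ → subst₂ _≤_ (cost-transpose G H c) (cost-transpose G H (flip c′)) (minimal (flip c′) c′≢)
  }
  where open MinCut M

module _ {G H : Graph} {c : Fin (n G) → Fin (n H) → Bool} (M : MinCut G H c) where

  open MinCut M

  K : Fin (n G) → Fin (n G) → ℕ
  K x x′ = κ H (c x) (c x′)

  -- `cost` contains the star of `x` twice, and the star has at least `p` edges. If each of them
  -- costs at least `q`, the budget `2 * (p * q)` is used up and none can cost more.
  star-tight : ∀ x → (∀ z → adj G x z ≡ true → q ≤ K x z) → ∀ z → adj G x z ≡ true → ¬ (q < K x z)
  star-tight x q≤K z xz q<K = <-irrefl refl (begin-strict
    2 * (p * q)                                ≡⟨ cong (2 *_) (*-comm p q) ⟩
    2 * (q * p)                                ≤⟨ *-monoʳ-≤ 2 (*-monoʳ-≤ q (p≤deg x)) ⟩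
    2 * (q * deg G x)                          ≡⟨ cong (2 *_) (star-const G x q) ⟨
    2 * ∑ (λ x′ → ⟦ adj G x x′ ⟧ * q)          <⟨ *-monoʳ-< 2 (star-mono-< G x q≤K z xz q<K) ⟩
    2 * ∑ (λ x′ → ⟦ adj G x x′ ⟧ * K x x′)     ≤⟨ 2star≤∑E G K (λ x x′ → κ-sym H (c x) (c x′)) x ⟩
    cost G H c                                 ≤⟨ cost≤2pq ⟩
    2 * (p * q)                                ∎)
    where open ≤-Reasoning

  -- If `2 * # s (c x) < q`, then by `small-side` every edge at `x` costs at least `q * # s (c x)`,
  -- hence at least `q`. The `mate` of a vertex of colour `s` in row `x` lies in a row that also
  -- contains `s`, and there the inequality is strict, against `star-tight`.
  balanced : ∀ {x} → NonConstant (c x) → ∀ s → q ≤ 2 * # s (c x)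
  balanced {x} nc s with q ≤? 2 * # s (c x)
  ... | yes q≤ = q≤
  ... | no  q≰ = contradiction
      (≤-<-trans q≤qa (<-≤-trans (proj₂ (small z) (#-positive s (c z) (trans cz≡ cx≡s))) (κ-count H q q≤deg s (c x) (c z))))
      (star-tight x (λ z _ → ≤-trans q≤qa (≤-trans (proj₁ (small z)) (κ-count H q q≤deg s (c x) (c z)))) z xz)
    where
    y = proj₁ (nc s)
    cx≡s = proj₂ (nc s)
    z = proj₁ (mate x y)
    xz = proj₁ (proj₂ (proj₂ (mate x y)))
    cz≡ = proj₂ (proj₂ (proj₂ (proj₂ (mate x y))))
    small : ∀ z → _
    small z = small-side q (# s (c x)) (# s (c z)) (≰⇒> q≰)
    q≤qa : q ≤ q * # s (c x)
    q≤qa = m≤m*n q (# s (c x)) ⦃ >-nonZero (#-positive s (c x) cx≡s) ⦄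

  -- If all neighbouring rows are constant, each edge at `x` costs at least `q` by `κ-constant`.
  -- Among three vertices some colour occurs twice in row `x`. A vertex of the other colour has its
  -- `mate` in a row consisting of that other colour only, and this edge costs at least `2 * q`,
  -- against `star-tight`.
  nonConstant-neighbour : 3 ≤ n H → ∀ {x} → NonConstant (c x) → ∃ λ z → adj G x z ≡ true × NonConstant (c z)
  nonConstant-neighbour 3≤m {x} nc with any? (λ z → (adj G x z ≟ᵇ true) ×-dec nonConstant? (c z) y₀)
    where y₀ = proj₁ (nc true)
  ... | yes found = found
  ... | no  ∄z    = contradiction (majority (2 ≤? # true (c x)) (2 ≤? # false (c x))) λ ()
    where
    y₀ = proj₁ (nc true)
    constant : ∀ z → adj G x z ≡ true → Constant (c z)
    constant z xz with constant⊎nonConstant (c z) y₀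
    ... | inj₁ k   = k
    ... | inj₂ nc′ = contradiction (z , xz , nc′) ∄z
    q≤K : ∀ z → adj G x z ≡ true → q ≤ K x z
    q≤K z xz with constant z xz
    ... | s , cz≡s = ≤-trans
      (m≤m*n q (# (not s) (c x)) ⦃ >-nonZero (#-positive (not s) (c x) (proj₂ (nc (not s)))) ⦄)
      (κ-constant H q q≤deg s (c x) (c z) cz≡s)
    two : ∀ s → ¬ (2 ≤ # (not s) (c x))
    two s 2≤# with nc s
    ... | y , cx≡s with mate x y
    ...   | z , y′ , xz , _ , eq with constant z xz
    ...     | t , cz≡t = star-tight x q≤K z xz (begin-strict
      q                  <⟨ m<m*n q 2 ⦃ >-nonZero 1≤q ⦄ (s≤s (s≤s z≤n)) ⟩
      q * 2              ≤⟨ *-monoʳ-≤ q 2≤# ⟩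
      q * # (not s) (c x)  ≤⟨ κ-constant H q q≤deg s (c x) (c z)
                              (λ y → trans (cz≡t y) (trans (≡.sym (cz≡t y′)) (trans eq cx≡s))) ⟩
      K x z              ∎)
      where open ≤-Reasoning
    majority : Dec (2 ≤ # true (c x)) → Dec (2 ≤ # false (c x)) → ⊥
    majority (yes 2≤t) _         = two false 2≤t
    majority (no _)    (yes 2≤f) = two true 2≤f
    majority (no 2≰t)  (no 2≰f)  = <⇒≱ 3≤m (begin
      n H                           ≡⟨ #-complement true (c x) ⟨
      # false (c x) + # true (c x)  ≤⟨ +-mono-≤ (≤-pred (≰⇒> 2≰f)) (≤-pred (≰⇒> 2≰t)) ⟩
      2                             ∎)
      where open ≤-Reasoning

  -- Constant and nonconstant rows together

  module Mixed (nb : NonBipartite H) (y₀ : Fin (n H)) where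

    row : ∀ x → Constant (c x) ⊎ NonConstant (c x)
    row x = constant⊎nonConstant (c x) y₀

    d e : Fin (n G) → ℕ
    d x = [ (λ _ → 0) , (λ _ → 1) ]′ (row x)
    e x = [ (λ _ → 1) , (λ _ → 0) ]′ (row x)

    -- s counts the nonconstant rows, I the ordered edges among them and O the edges leaving them.
    I O s : ℕ
    I = ∑E G λ x x′ → d x * d x′
    O = ∑E G λ x x′ → d x * e x′
    s = ∑ d

    d≡1 : ∀ {x} → NonConstant (c x) → d x ≡ 1
    d≡1 {x} nc with row x
    ... | inj₁ k = contradiction k (¬constant nc)
    ... | inj₂ _ = refl

    e≡1 : ∀ {x} → Constant (c x) → e x ≡ 1
    e≡1 {x} k with row x
    ... | inj₁ _  = refl
    ... | inj₂ nc = contradiction k (¬constant nc)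

    d+e≡1 : ∀ x → d x + e x ≡ 1
    d+e≡1 x with row x
    ... | inj₁ _ = refl
    ... | inj₂ _ = refl

    -- `O` holds each edge between the two kinds of rows in one orientation and `cost` in both,
    -- hence the factor 2. The scale `r` admits fractional bounds: q²/2 is expressed by `r = 2` and
    -- `β = q * q`.
    cost-bound : ∀ r α β →
      (∀ x x′ → NonConstant (c x) → α ≤ r * K x x′) →
      (∀ x x′ → NonConstant (c x) → Constant (c x′) → β ≤ r * K x x′) →
      α * I + 2 * (β * O) ≤ r * cost G H c
    cost-bound r α β α≤ β≤ = begin
      α * I + 2 * (β * O)      ≡⟨ cong (α * I +_) (cong (β * O +_) (+-identityʳ _)) ⟩
      α * I + (β * O + β * O)  ≡⟨ cong₂ (λ a b → a + (b + β * O)) (∑E-* G α _) (∑E-* G β _) ⟨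
      ∑E G (λ x x′ → α * (d x * d x′)) + (∑E G (λ x x′ → β * (d x * e x′)) + β * O)
        ≡⟨ cong (λ o → ∑E G (λ x x′ → α * (d x * d x′)) + (∑E G (λ x x′ → β * (d x * e x′)) + o))
                (trans (∑E-* G β _) (cong (β *_) (∑E-flip G (λ x x′ → d x′ * e x)))) ⟨
      ∑E G (λ x x′ → α * (d x * d x′)) + (∑E G (λ x x′ → β * (d x * e x′)) + ∑E G (λ x x′ → β * (d x′ * e x)))
        ≡⟨ trans (∑E-+ G _ _) (cong (∑E G (λ x x′ → α * (d x * d x′)) +_) (∑E-+ G _ _)) ⟨
      ∑E G (λ x x′ → α * (d x * d x′) + (β * (d x * e x′) + β * (d x′ * e x)))
        ≤⟨ ∑E-mono G (λ x x′ _ → each x x′) ⟩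
      ∑E G (λ x x′ → r * K x x′)  ≡⟨ ∑E-* G r K ⟩
      r * cost G H c              ∎
      where
      open ≤-Reasoning
      1+0+0 : ∀ a b → a * 1 + (b * 0 + b * 0) ≡ a
      1+0+0 = solve-∀
      0+1+0 : ∀ a b → a * 0 + (b * 1 + b * 0) ≡ b
      0+1+0 = solve-∀
      0+0+1 : ∀ a b → a * 0 + (b * 0 + b * 1) ≡ b
      0+0+1 = solve-∀
      0+0+0 : ∀ a b → a * 0 + (b * 0 + b * 0) ≡ 0
      0+0+0 = solve-∀
      each : ∀ x x′ → α * (d x * d x′) + (β * (d x * e x′) + β * (d x′ * e x)) ≤ r * K x x′
      each x x′ with row x | row x′
      ... | inj₂ nc | inj₂ _   = ≤-trans (≤-reflexive (1+0+0 α β)) (α≤ x x′ nc)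
      ... | inj₂ nc | inj₁ k   = ≤-trans (≤-reflexive (0+1+0 α β)) (β≤ x x′ nc k)
      ... | inj₁ k  | inj₂ nc  = ≤-trans (≤-reflexive (0+0+1 α β))
                                         (subst (λ k → β ≤ r * k) (κ-sym H (c x′) (c x)) (β≤ x′ x nc k))
      ... | inj₁ _  | inj₁ _   = ≤-trans (≤-reflexive (0+0+0 α β)) z≤n

    I+2qO≤2pq : I + 2 * (q * O) ≤ 2 * (p * q)
    I+2qO≤2pq = begin
      I + 2 * (q * O)      ≡⟨ cong (_+ 2 * (q * O)) (*-identityˡ I) ⟨
      1 * I + 2 * (q * O)  ≤⟨ cost-bound 1 1 q
                                (λ x x′ nc → ≤-trans (κ-positive H nb connH nc (c x′)) (≤-reflexive (≡.sym (*-identityˡ _))))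
                                (λ x x′ nc (s , cx′≡s) → ≤-trans
                                  (m≤m*n q (# (not s) (c x)) ⦃ >-nonZero (#-positive (not s) (c x) (proj₂ (nc (not s)))) ⦄)
                                  (≤-trans (κ-constant H q q≤deg s (c x) (c x′) cx′≡s) (≤-reflexive (≡.sym (*-identityˡ _))))) ⟩
      1 * cost G H c       ≡⟨ *-identityˡ _ ⟩
      cost G H c           ≤⟨ cost≤2pq ⟩
      2 * (p * q)          ∎
      where open ≤-Reasoning

    -- By `balanced`, the colour that the constant row misses occurs at least q/2 times in the
    -- nonconstant row, so an edge between the two costs at least q²/2.
    I+q²O≤2pq : I + q * q * O ≤ 2 * (p * q)
    I+q²O≤2pq = *-cancelˡ-≤ 2 (begin
      2 * (I + q * q * O)           ≡⟨ *-distribˡ-+ 2 I _ ⟩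
      2 * I + 2 * (q * q * O)       ≤⟨ cost-bound 2 2 (q * q)
                                        (λ x x′ nc → *-monoʳ-≤ 2 (κ-positive H nb connH nc (c x′)))
                                        (λ x x′ nc (s , cx′≡s) → ≤-trans
                                          (*-monoʳ-≤ q (balanced nc (not s)))
                                          (≤-trans (≤-reflexive (exchange q 2 (# (not s) (c x))))
                                            (*-monoʳ-≤ 2 (κ-constant H q q≤deg s (c x) (c x′) cx′≡s)))) ⟩
      2 * cost G H c                ≤⟨ *-monoʳ-≤ 2 cost≤2pq ⟩
      2 * (2 * (p * q))             ∎)
      where open ≤-Reasoning

    ps≤I+O : p * s ≤ I + O
    ps≤I+O = begin
      p * s                                     ≡⟨ ∑-* p d ⟨
      ∑ (λ x → p * d x)                         ≤⟨ ∑-mono (λ x → ≤-trans (≤-reflexive (*-comm p (d x))) (*-monoʳ-≤ (d x) (p≤deg x))) ⟩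
      ∑ (λ x → d x * deg G x)                   ≡⟨ ∑E-source G d ⟨
      ∑E G (λ x _ → d x)                        ≡⟨ ∑E-cong G (λ x x′ _ → trans (≡.sym (*-identityʳ (d x)))
                                                     (trans (cong (d x *_) (≡.sym (d+e≡1 x′))) (*-distribˡ-+ (d x) (d x′) (e x′)))) ⟩
      ∑E G (λ x x′ → d x * d x′ + d x * e x′)   ≡⟨ ∑E-+ G _ _ ⟩
      I + O                                     ∎
      where open ≤-Reasoning

    -- A vertex of a set of s ≤ p vertices has at least p + 1 − s neighbours outside the set.
    s≤p⇒p≤O : 1 ≤ s → s ≤ p → p ≤ O
    s≤p⇒p≤O 1≤s s≤p = begin
      p                                                  ≤⟨ product s p 1≤s s≤p ⟩
      (suc p ∸ s) * s                                    ≡⟨ ∑-* (suc p ∸ s) d ⟨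
      ∑ (λ x → (suc p ∸ s) * d x)                        ≤⟨ ∑-mono each ⟩
      ∑ (λ x → d x * ∑ (λ x′ → ⟦ adj G x x′ ⟧ * e x′))   ≡⟨ ∑-cong (λ x → trans (≡.sym (∑-* {n G} (d x) _))
                                                             (∑-cong λ x′ → ≡.sym (exchange ⟦ adj G x x′ ⟧ (d x) (e x′)))) ⟩
      O                                                  ∎
      where
      open ≤-Reasoning
      product : ∀ s p → 1 ≤ s → s ≤ p → p ≤ (suc p ∸ s) * s
      product (suc i) p 1≤s s≤p = begin
        p                      ≡⟨ m∸n+n≡m (≤-trans (n≤1+n i) s≤p) ⟨
        (p ∸ i) + i            ≤⟨ +-monoʳ-≤ (p ∸ i) (m≤n*m i (p ∸ i) ⦃ >-nonZero (m<n⇒0<n∸m s≤p) ⦄) ⟩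
        (p ∸ i) + (p ∸ i) * i  ≡⟨ *-suc (p ∸ i) i ⟨
        (p ∸ i) * suc i        ∎
      -- The vertex `x` is one of the `s` vertices but not its own neighbour, hence `suc`.
      inner : ∀ x → d x ≡ 1 → suc (∑ (λ x′ → ⟦ adj G x x′ ⟧ * d x′)) ≤ s
      inner x dx≡1 = ∑-mono-< (λ x′ → ≤-trans (*-monoˡ-≤ (d x′) (⟦⟧≤1 (adj G x x′))) (≤-reflexive (*-identityˡ _))) x
        (subst₂ _<_ (cong (λ b → ⟦ b ⟧ * d x) (≡.sym (irrefl G x))) (≡.sym dx≡1) (s≤s z≤n))
      outer : ∀ x → d x ≡ 1 → suc p ∸ s ≤ ∑ (λ x′ → ⟦ adj G x x′ ⟧ * e x′)
      outer x dx≡1 = m≤n+o⇒m∸n≤o (suc p) s (begin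
        suc p                                             ≤⟨ s≤s (p≤deg x) ⟩
        suc (deg G x)                                     ≡⟨ cong suc (∑-cong λ x′ → trans (≡.sym (*-identityʳ _))
                                                              (trans (cong (⟦ adj G x x′ ⟧ *_) (≡.sym (d+e≡1 x′)))
                                                                (*-distribˡ-+ ⟦ adj G x x′ ⟧ (d x′) (e x′)))) ⟩
        suc (∑ (λ x′ → ⟦ adj G x x′ ⟧ * d x′ + ⟦ adj G x x′ ⟧ * e x′))  ≡⟨ cong suc (∑-+ {n G} _ _) ⟩
        suc (∑ (λ x′ → ⟦ adj G x x′ ⟧ * d x′)) + ∑ (λ x′ → ⟦ adj G x x′ ⟧ * e x′)  ≤⟨ +-monoˡ-≤ _ (inner x dx≡1) ⟩
        s + ∑ (λ x′ → ⟦ adj G x x′ ⟧ * e x′)              ∎)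
      each : ∀ x → (suc p ∸ s) * d x ≤ d x * ∑ (λ x′ → ⟦ adj G x x′ ⟧ * e x′)
      each x with row x | outer x
      ... | inj₁ _ | _     = ≤-reflexive (*-zeroʳ (suc p ∸ s))
      ... | inj₂ _ | outer = ≤-trans (≤-reflexive (*-identityʳ _)) (≤-trans (outer refl) (≤-reflexive (≡.sym (*-identityˡ _))))

    -- As `I ≥ 1`, the bound `I+2qO≤2pq` gives `O < p`, so `s > p` by `s≤p⇒p≤O`, and p(p + 1) ≤ I +
    -- O by `ps≤I+O`. On the other hand I + q²O ≤ 2pq ≤ p² + q². The two clash because O + q² ≤ q²O
    -- + 1, that is (q² - 1)(O - 1) ≥ 0, and because 1 ≤ O < p makes p > 1.
    impossible : 1 ≤ I → 1 ≤ O → 1 ≤ s → ⊥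
    impossible 1≤I 1≤O 1≤s = <-irrefl refl (begin-strict
      2 * (p * q) + 1          ≤⟨ +-monoˡ-≤ 1 (2*m*n≤m²+n² p q) ⟩
      p * p + q * q + 1        <⟨ +-monoʳ-< (p * p + q * q) (≤-trans (s≤s 1≤O) O<p) ⟩
      p * p + q * q + p        ≡⟨ regroup p q ⟩
      p * suc p + q * q        ≤⟨ +-monoˡ-≤ (q * q) (*-monoʳ-≤ p p<s) ⟩
      p * s + q * q            ≤⟨ +-monoˡ-≤ (q * q) ps≤I+O ⟩
      I + O + q * q            ≤⟨ absorb O 1≤O ⟩
      I + q * q * O + 1        ≤⟨ +-monoˡ-≤ 1 I+q²O≤2pq ⟩
      2 * (p * q) + 1          ∎)
      where
      open ≤-Reasoning
      regroup : ∀ p q → p * p + q * q + p ≡ p * suc p + q * q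
      regroup = solve-∀
      O<p : O < p
      O<p = ≰⇒> λ p≤O → <-irrefl refl (begin-strict
        2 * (p * q)      ≡⟨ cong (2 *_) (*-comm p q) ⟩
        2 * (q * p)      ≤⟨ *-monoʳ-≤ 2 (*-monoʳ-≤ q p≤O) ⟩
        2 * (q * O)      <⟨ +-monoˡ-< (2 * (q * O)) 1≤I ⟩
        I + 2 * (q * O)  ≤⟨ I+2qO≤2pq ⟩
        2 * (p * q)      ∎)
      p<s : p < s
      p<s = ≰⇒> λ s≤p → <⇒≱ O<p (s≤p⇒p≤O 1≤s s≤p)
      shuffle : ∀ i o r → i + suc o + r ≡ i + (r + o) + 1
      shuffle = solve-∀
      absorb : ∀ o → 1 ≤ o → I + o + q * q ≤ I + q * q * o + 1
      absorb (suc o) _ = begin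
        I + suc o + q * q            ≡⟨ shuffle I o (q * q) ⟩
        I + (q * q + o) + 1          ≤⟨ +-monoˡ-≤ 1 (+-monoʳ-≤ I (+-monoʳ-≤ (q * q) (m≤n*m o (q * q) ⦃ >-nonZero (*-mono-≤ 1≤q 1≤q) ⦄))) ⟩
        I + (q * q + q * q * o) + 1  ≡⟨ cong (λ k → I + k + 1) (*-suc (q * q) o) ⟨
        I + q * q * suc o + 1        ∎

    -- If no edge leaves the nonconstant rows, connectedness of `G` spreads nonconstancy to every
    -- row; `impossible` excludes the other case.
    nonConstant-rows : ∀ {x} → NonConstant (c x) → ∀ z → NonConstant (c z)
    nonConstant-rows {x} nc z with 1 ≤? O
    ... | yes 1≤O = contradiction 1≤s (impossible 1≤I 1≤O)
      where
      neighbour = nonConstant-neighbour (nonBipartite⇒3≤n H nb) nc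
      1≤I : 1 ≤ I
      1≤I = ≤-trans (≤-reflexive (cong₂ _*_ (≡.sym (d≡1 nc)) (≡.sym (d≡1 (proj₂ (proj₂ neighbour))))))
                    (≤∑E G (λ x x′ → d x * d x′) x (proj₁ neighbour) (proj₁ (proj₂ neighbour)))
      1≤s : 1 ≤ s
      1≤s = ≤-trans (≤-reflexive (≡.sym (d≡1 nc))) (≤∑ d x)
    ... | no  1≰O = Reach-preserves (NonConstant ∘ c) closed (connG x z) nc
      where
      closed : ∀ {u v} → adj G u v ≡ true → NonConstant (c u) → NonConstant (c v)
      closed {u} {v} uv nc with row v
      ... | inj₂ nc′ = nc′
      ... | inj₁ k   = contradiction
        (≤-trans (≤-reflexive (cong₂ _*_ (≡.sym (d≡1 nc)) (≡.sym (e≡1 k)))) (≤∑E G (λ x x′ → d x * e x′) u v uv))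
        1≰O

-- Both factors nonbipartite

module _ {G H : Graph} {c : Fin (n G) → Fin (n H) → Bool} (M : MinCut G H c) where

  open MinCut M

  n*p≤vol : n G * p ≤ vol G
  n*p≤vol = ≤-trans (≤-reflexive (≡.sym (∑-const (n G) p))) (∑-mono p≤deg)

  module _ (nbH : NonBipartite H) (nc : ∀ x → NonConstant (c x)) where

    1≤K : ∀ x x′ → 1 ≤ K M x x′
    1≤K x x′ = κ-positive H nbH connH (nc x) (c x′)

    vol≤cost : vol G ≤ cost G H c
    vol≤cost = ≤-trans (≤-reflexive (≡.sym (trans (∑E-const G 1) (*-identityˡ _)))) (∑E-mono G λ x x′ _ → 1≤K x x′)

    -- Otherwise the cost is at least `q * vol G`, hence at least `n G * (p * q)`, and `n G ≥ 3`
    -- puts this above the budget.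
    cheap-edge : 3 ≤ n G → ∃₂ λ x x′ → adj G x x′ ≡ true × K M x x′ < q
    cheap-edge 3≤n with any? (λ x → any? λ x′ → (adj G x x′ ≟ᵇ true) ×-dec (K M x x′ <? q))
    ... | yes found = found
    ... | no  ∄     = contradiction cost≤2pq (<⇒≱ (begin-strict
      2 * (p * q)               <⟨ *-monoˡ-< (p * q) ⦃ >-nonZero (*-mono-≤ 1≤p 1≤q) ⦄ (n<1+n 2) ⟩
      3 * (p * q)               ≤⟨ *-monoˡ-≤ (p * q) 3≤n ⟩
      n G * (p * q)             ≡⟨ assemble (n G) p q ⟩
      q * (n G * p)             ≤⟨ *-monoʳ-≤ q n*p≤vol ⟩
      q * vol G                 ≡⟨ ∑E-const G q ⟨
      ∑E G (λ _ _ → q)          ≤⟨ ∑E-mono G (λ x x′ xx′ → ≮⇒≥ λ K<q → ∄ (x , x′ , xx′ , K<q)) ⟩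
      cost G H c                ∎))
      where
      open ≤-Reasoning
      assemble : ∀ n p q → n * (p * q) ≡ q * (n * p)
      assemble = solve-∀

    q≤# : ∀ x x′ → K M x x′ < q → ∀ s → q ≤ # s (c x)
    q≤# x x′ K<q s = large-side q (# s (c x)) (# s (c x′)) (#-positive s (c x) (proj₂ (nc x s)))
      (≤-<-trans (κ-count H q q≤deg s (c x) (c x′)) K<q)

    -- At a cheap edge `large-side` applies to both colours of row `x`.
    2q≤n : 3 ≤ n G → 2 * q ≤ n H
    2q≤n 3≤n with cheap-edge 3≤n
    ... | x , x′ , _ , K<q = begin
      2 * q                         ≡⟨ cong (q +_) (+-identityʳ q) ⟩
      q + q                         ≤⟨ +-mono-≤ (q≤# x x′ K<q false) (q≤# x x′ K<q true) ⟩
      # false (c x) + # true (c x)  ≡⟨ #-complement true (c x) ⟩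
      n H                           ∎
      where open ≤-Reasoning

    -- If vol H = 2q² then both layers of a cheap cut have volume q², so the two kinds of cut edges
    -- are equinumerous and the cut is even.
    2≤K : vol H ≤ 2 * (q * q) → ∀ x x′ → K M x x′ < q → 2 ≤ K M x x′
    2≤K vol≤2q² x x′ K<q = even crossing≡ (κ-split H q q≤deg true (c x) (c x′)) (1≤K x x′)
      where
      open ≤-Reasoning
      volume : Bool → (Fin (n H) → Bool) → ℕ
      volume s Y = ∑E H λ y _ → ind s (Y y)
      crossing inside : (Y Z : Fin (n H) → Bool) → ℕ
      crossing Y Z = ∑E H λ y y′ → ind true (Y y) * ind false (Z y′)
      inside   Y Z = ∑E H λ y y′ → ind true (Y y) * ind true (Z y′)
      q²≤volume : ∀ {Y} s → q ≤ # s Y → q * q ≤ volume s Y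
      q²≤volume {Y} s q≤# = begin
        q * q                                ≤⟨ *-monoʳ-≤ q q≤# ⟩
        q * # s Y                            ≡⟨ ∑-* q (λ y → ind s (Y y)) ⟨
        ∑ (λ y → q * ind s (Y y))            ≤⟨ ∑-mono (λ y → ≤-trans (*-monoˡ-≤ (ind s (Y y)) (q≤deg y)) (≤-reflexive (*-comm (deg H y) _))) ⟩
        ∑ (λ y → ind s (Y y) * deg H y)      ≡⟨ ∑E-source H _ ⟨
        volume s Y                           ∎
      volume-complement : ∀ Y → volume false Y + volume true Y ≡ vol H
      volume-complement Y = trans (≡.sym (∑E-+ H _ _)) (trans (∑E-cong H λ y _ _ → ind-complement true (Y y))
        (trans (∑E-const H 1) (*-identityˡ _)))
      volume≡q² : ∀ {Y} → (∀ s → q ≤ # s Y) → volume true Y ≡ q * q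
      volume≡q² {Y} q≤# = ≤-antisym (+-cancelˡ-≤ (q * q) _ _ (begin
        q * q + volume true Y           ≤⟨ +-monoˡ-≤ _ (q²≤volume false (q≤# false)) ⟩
        volume false Y + volume true Y  ≡⟨ volume-complement Y ⟩
        vol H                           ≤⟨ vol≤2q² ⟩
        2 * (q * q)                     ≡⟨ cong (q * q +_) (+-identityʳ _) ⟩
        q * q + q * q                   ∎)) (q²≤volume true (q≤# true))
      crossing+inside : ∀ Y Z → crossing Y Z + inside Y Z ≡ volume true Y
      crossing+inside Y Z = trans (≡.sym (∑E-+ H _ _)) (∑E-cong H λ y y′ _ →
        trans (≡.sym (*-distribˡ-+ (ind true (Y y)) _ _))
          (trans (cong (ind true (Y y) *_) (ind-complement true (Z y′))) (*-identityʳ _)))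
      inside-sym : ∀ Y Z → inside Y Z ≡ inside Z Y
      inside-sym Y Z = trans (∑E-flip H _) (∑E-cong H λ y y′ _ → *-comm (ind true (Y y′)) _)
      -- Each kind of cut edge, together with `inside`, makes up the volume q² of the `true`
      -- vertices of one layer, and `inside` is symmetric in the two layers.
      crossing≡ : crossing (c x) (c x′) ≡ crossing (c x′) (c x)
      crossing≡ = +-cancelʳ-≡ (inside (c x) (c x′)) _ _ (begin-equality
        crossing (c x) (c x′) + inside (c x) (c x′)  ≡⟨ crossing+inside (c x) (c x′) ⟩
        volume true (c x)                            ≡⟨ volume≡q² (q≤# x x′ K<q) ⟩
        q * q                                        ≡⟨ volume≡q² (q≤# x′ x (subst (_< q) (κ-sym H (c x) (c x′)) K<q)) ⟨
        volume true (c x′)                           ≡⟨ crossing+inside (c x′) (c x) ⟨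
        crossing (c x′) (c x) + inside (c x′) (c x)  ≡⟨ cong (crossing (c x′) (c x) +_) (inside-sym (c x′) (c x)) ⟩
        crossing (c x′) (c x) + inside (c x) (c x′)  ∎)
      even : ∀ {a b k} → a ≡ b → k ≡ a + b → 1 ≤ k → 2 ≤ k
      even {suc a} refl refl _ = s≤s (≤-trans (s≤s z≤n) (m≤n+m (suc a) a))

-- The chain 2p² ≤ p · |V(G)| ≤ vol G ≤ cost ≤ 2pq gives `p ≤ q`, and the transposed chain gives
-- `q ≤ p`. Then `vol H ≤ 2 * (q * q)`, so `2≤K` applies to a cheap edge. As vol G ≤ cost charges
-- only 1 for that edge, it is strict, and the chain ends in 2pq < 2pq.
both-nonBipartite : ∀ {G H c} → MinCut G H c → NonBipartite G → NonBipartite H →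
                    (∀ x → NonConstant (c x)) → (∀ y → NonConstant (flip c y)) → ⊥
both-nonBipartite {G} {H} {c} M nbG nbH ncr ncc with cheap-edge M nbH ncr (nonBipartite⇒3≤n G nbG)
... | x , x′ , xx′ , K<q = <-irrefl refl (begin-strict
  2 * (p * q)        ≡⟨ cong (λ k → 2 * (p * k)) (≤-antisym p≤q q≤p) ⟨
  2 * (p * p)        ≤⟨ 2p²≤vol ⟩
  vol G              ≡⟨ trans (∑E-const G 1) (*-identityˡ _) ⟨
  ∑E G (λ _ _ → 1)   <⟨ ∑E-mono-< G (λ x x′ _ → 1≤K M nbH ncr x x′) x x′ xx′ (2≤K M nbH ncr vol≤2q² x x′ K<q) ⟩
  cost G H c         ≤⟨ cost≤2pq ⟩
  2 * (p * q)        ∎)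
  where
  open MinCut M
  open ≤-Reasoning
  Mᵀ = transpose M
  2p²≤vol : 2 * (p * p) ≤ vol G
  2p²≤vol = ≤-trans (≤-reflexive (≡.sym (*-assoc 2 p p)))
    (≤-trans (*-monoˡ-≤ p (2q≤n Mᵀ nbG ncc (nonBipartite⇒3≤n H nbH))) (n*p≤vol M))
  2q²≤vol : 2 * (q * q) ≤ vol H
  2q²≤vol = ≤-trans (≤-reflexive (≡.sym (*-assoc 2 q q)))
    (≤-trans (*-monoˡ-≤ q (2q≤n M nbH ncr (nonBipartite⇒3≤n G nbG))) (n*p≤vol Mᵀ))
  vol≤2pq : vol H ≤ 2 * (p * q)
  vol≤2pq = ≤-trans (vol≤cost Mᵀ nbG ncc) (≤-trans (≤-reflexive (≡.sym (cost-transpose G H c))) cost≤2pq)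
  p≤q : p ≤ q
  p≤q = *-cancelˡ-≤ p ⦃ >-nonZero 1≤p ⦄ (*-cancelˡ-≤ 2 (≤-trans 2p²≤vol (≤-trans (vol≤cost M nbH ncr) cost≤2pq)))
  q≤p : q ≤ p
  q≤p = *-cancelʳ-≤ q p q ⦃ >-nonZero 1≤q ⦄ (*-cancelˡ-≤ 2 (≤-trans 2q²≤vol vol≤2pq))
  vol≤2q² : vol H ≤ 2 * (q * q)
  vol≤2q² = ≤-trans vol≤2pq (*-monoʳ-≤ 2 (*-monoˡ-≤ q p≤q))

-- A bipartite factor

module _ {G H : Graph} {c : Fin (n G) → Fin (n H) → Bool} (M : MinCut G H c)
         (φ : Fin (n G) → Bool) (proper : Proper G φ) (nc : ∀ x → NonConstant (c x)) where

  open MinCut M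

  -- Spreading the rows x and x′ over the two colour classes of G cuts every edge of G as xx′ is cut.
  spread : ∀ x x′ → adj G x x′ ≡ true → cost G H c ≤ vol G * K M x x′
  spread x x′ xx′ = ≤-trans (minimal c′ distinct) (≤-reflexive
    (trans (∑E-cong G λ z z′ zz′ → edge z z′ (proper z z′ zz′)) (trans (∑E-const G _) (*-comm _ (vol G)))))
    where
    c′ : Fin (n G) → Fin (n H) → Bool
    c′ z = if does (φ z ≟ᵇ φ x) then c x else c x′
    c′x : ∀ y → c′ x y ≡ c x y
    c′x y with φ x ≟ᵇ φ x
    ... | yes _ = refl
    ... | no  h = contradiction refl h
    distinct : c′ x (proj₁ (nc x true)) ≢ c′ x (proj₁ (nc x false))
    distinct eq = contradiction
      (trans (≡.sym (proj₂ (nc x true))) (trans (≡.sym (c′x _)) (trans eq (trans (c′x _) (proj₂ (nc x false))))))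
      λ ()
    edge : ∀ z z′ → φ z ≢ φ z′ → κ H (c′ z) (c′ z′) ≡ K M x x′
    edge z z′ φz≢φz′ with φ z ≟ᵇ φ x | φ z′ ≟ᵇ φ x
    ... | yes a | yes b = contradiction (trans a (≡.sym b)) φz≢φz′
    ... | yes _ | no _  = refl
    ... | no _  | yes _ = κ-sym H (c x′) (c x)
    ... | no a  | no b  = contradiction (trans (¬-not a) (≡.sym (¬-not b))) φz≢φz′

  -- The costs K average to cost / vol G, so none of them exceeds the common lower bound.
  spread-equality : ∀ x x′ → adj G x x′ ≡ true → vol G * K M x x′ ≤ cost G H c
  spread-equality x x′ xx′ = ≮⇒≥ λ cost< → <-irrefl
    (trans (∑E-const G (cost G H c)) (trans (*-comm (cost G H c) (vol G)) (≡.sym (∑E-* G (vol G) (K M)))))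
    (∑E-mono-< G spread x x′ xx′ cost<)

  -- Rows `x` and `x″` have opposite colours at `y`, so each neighbour of `y`, taken in row `z`,
  -- disagrees with exactly one of them. Together the two edges cost at least deg y ≥ q, while
  -- `spread-equality` bounds `vol G` times each cost by `cost`, hence by 2pq.
  distinct-rows⇒vol≤4p : ∀ {x z x″ y} → adj G x z ≡ true → adj G x″ z ≡ true → c x y ≢ c x″ y → vol G ≤ 4 * p
  distinct-rows⇒vol≤4p {x} {z} {x″} {y} xz x″z c≢ = *-cancelʳ-≤ (vol G) (4 * p) q ⦃ >-nonZero 1≤q ⦄ (begin
    vol G * q                            ≤⟨ *-monoʳ-≤ (vol G) q≤K+K ⟩
    vol G * (K M x z + K M x″ z)         ≡⟨ *-distribˡ-+ (vol G) _ _ ⟩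
    vol G * K M x z + vol G * K M x″ z   ≤⟨ +-mono-≤ (spread-equality x z xz) (spread-equality x″ z x″z) ⟩
    cost G H c + cost G H c              ≤⟨ +-mono-≤ cost≤2pq cost≤2pq ⟩
    2 * (p * q) + 2 * (p * q)            ≡⟨ double p q ⟩
    4 * p * q                            ∎)
    where
    open ≤-Reasoning
    double : ∀ p q → 2 * (p * q) + 2 * (p * q) ≡ 4 * p * q
    double = solve-∀
    opposite : ∀ {a b} t → a ≢ b → 1 ≡ ⟦ a xor t ⟧ + ⟦ b xor t ⟧
    opposite {true}  {true}  t     a≢b = contradiction refl a≢b
    opposite {true}  {false} true  a≢b = refl
    opposite {true}  {false} false a≢b = refl
    opposite {false} {true}  true  a≢b = refl
    opposite {false} {true}  false a≢b = refl
    opposite {false} {false} t     a≢b = contradiction refl a≢b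
    at-y : Fin (n G) → ℕ
    at-y x = ∑ λ y′ → ⟦ adj H y y′ ⟧ * ⟦ c x y xor c z y′ ⟧
    q≤K+K : q ≤ K M x z + K M x″ z
    q≤K+K = begin
      q                  ≤⟨ q≤deg y ⟩
      deg H y            ≡⟨ ∑-cong (λ y′ → trans (≡.sym (*-identityʳ _)) (trans
                              (cong (⟦ adj H y y′ ⟧ *_) (opposite (c z y′) c≢)) (*-distribˡ-+ ⟦ adj H y y′ ⟧ _ _))) ⟩
      ∑ (λ y′ → ⟦ adj H y y′ ⟧ * ⟦ c x y xor c z y′ ⟧ + ⟦ adj H y y′ ⟧ * ⟦ c x″ y xor c z y′ ⟧)  ≡⟨ ∑-+ {n H} _ _ ⟩
      at-y x + at-y x″   ≤⟨ +-mono-≤ (≤∑ {n H} (λ y → ∑ λ y′ → ⟦ adj H y y′ ⟧ * ⟦ c x y xor c z y′ ⟧) y)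
                                     (≤∑ {n H} (λ y → ∑ λ y′ → ⟦ adj H y y′ ⟧ * ⟦ c x″ y xor c z y′ ⟧) y) ⟩
      K M x z + K M x″ z ∎

∧-true : ∀ {a b} → a ∧ b ≡ true → a ≡ true × b ≡ true
∧-true {true} {true} _ = refl , refl

-- Recognising P₃ and C₄

-- Pigeonhole: a missed `w` would extend `f` to an injection of k + 1 points into `N ≤ k` points.
injective⇒surjective : ∀ {k N} (f : Fin k → Fin N) → (∀ i j → f i ≡ f j → i ≡ j) → N ≤ k → ∀ w → ∃ λ i → f i ≡ w
injective⇒surjective {k} {N} f inj N≤k w with any? (λ i → f i ≟ w)
... | yes found = found
... | no  ∄i    = contradiction (injective⇒≤ {f = g} g-injective) (<⇒≱ (s≤s N≤k))
  where
  g : Fin (suc k) → Fin N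
  g zero    = w
  g (suc i) = f i
  g-injective : ∀ {i j} → g i ≡ g j → i ≡ j
  g-injective {zero}  {zero}  _  = refl
  g-injective {zero}  {suc j} eq = contradiction (j , ≡.sym eq) ∄i
  g-injective {suc i} {zero}  eq = contradiction (i , eq) ∄i
  g-injective {suc i} {suc j} eq = cong suc (inj i j eq)

injective⇒≅ : ∀ G F (f : Fin (n F) → Fin (n G)) → (∀ i j → f i ≡ f j → i ≡ j) → n G ≤ n F →
              (∀ i j → adj G (f i) (f j) ≡ adj F i j) → G ≅ F
injective⇒≅ G F f inj nG≤nF f-adj = mk↔ₛ′ g f (λ i → inj _ _ (f∘g (f i))) f∘g ,
  λ x y → trans (≡.sym (cong₂ (adj G) (f∘g x) (f∘g y))) (f-adj (g x) (g y))
  where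
  g : Fin (n G) → Fin (n F)
  g w = proj₁ (injective⇒surjective f inj nG≤nF w)
  f∘g : ∀ w → f (g w) ≡ w
  f∘g w = proj₂ (injective⇒surjective f inj nG≤nF w)

two-neighbours⇒2≤deg : ∀ G {v a b} → adj G v a ≡ true → adj G v b ≡ true → a ≢ b → 2 ≤ deg G v
two-neighbours⇒2≤deg G {v} {a} {b} va vb a≢b = begin
  1 + 1                                   ≡⟨ cong₂ _+_ (∑-δ a (λ _ → 1)) (∑-δ b (λ _ → 1)) ⟨
  ∑ (λ w → δ a w * 1) + ∑ (λ w → δ b w * 1)  ≡⟨ ∑-+ {n G} _ _ ⟨
  ∑ (λ w → δ a w * 1 + δ b w * 1)         ≤⟨ ∑-mono each ⟩
  deg G v                                 ∎
  where
  open ≤-Reasoning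
  δ : Fin (n G) → Fin (n G) → ℕ
  δ u w = ⟦ does (w ≟ u) ⟧
  each : ∀ w → δ a w * 1 + δ b w * 1 ≤ ⟦ adj G v w ⟧
  each w with w ≟ a | w ≟ b
  ... | yes refl | yes refl = contradiction refl a≢b
  ... | yes refl | no _     = ≤-reflexive (cong ⟦_⟧ (≡.sym va))
  ... | no _     | yes refl = ≤-reflexive (cong ⟦_⟧ (≡.sym vb))
  ... | no _     | no _     = z≤n

another-neighbour : ∀ G {v} → 2 ≤ deg G v → ∀ u → ∃ λ w → adj G v w ≡ true × w ≢ u
another-neighbour G {v} 2≤deg u with any? (λ w → (adj G v w ≟ᵇ true) ×-dec ¬? (w ≟ u))
... | yes found = found
... | no  ∄w    = contradiction 2≤deg (<⇒≱ (s≤s (begin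
  deg G v                                      ≤⟨ ∑-mono each ⟩
  ∑ (λ w → ⟦ does (w ≟ u) ⟧ * 1)      ≡⟨ ∑-δ u (λ _ → 1) ⟩
  1                                            ∎)))
  where
  open ≤-Reasoning
  each : ∀ w → ⟦ adj G v w ⟧ ≤ ⟦ does (w ≟ u) ⟧ * 1
  each w with w ≟ u | adj G v w in vw
  ... | yes _  | true  = ≤-refl
  ... | yes _  | false = z≤n
  ... | no w≢u | true  = contradiction (w , vw , w≢u) ∄w
  ... | no _   | false = z≤n

module _ (G : Graph) (p : ℕ) (1≤p : 1 ≤ p) (p≤deg : ∀ x → p ≤ deg G x) (vol≤4p : vol G ≤ 4 * p)
         (φ : Fin (n G) → Bool) (proper : Proper G φ) where

  non-adjacent : ∀ {a b} → φ a ≡ φ b → adj G a b ≡ false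
  non-adjacent {a} {b} φa≡φb = ¬-not (λ ab → proper a b ab φa≡φb)

  same-colour : ∀ {a b d} → adj G a d ≡ true → adj G b d ≡ true → φ a ≡ φ b
  same-colour {a} {b} {d} ad bd = trans (¬-not (proper a d ad)) (≡.sym (¬-not (proper b d bd)))

  -- From n p ≤ vol G ≤ 4p there are at most four vertices. If there are at most three, `x`, `z`,
  -- `x″` are all of them. If there are four, equality makes every degree equal to `p`, and `p ≥ 2`
  -- because `z` has two neighbours. So `x` has a second neighbour `w`, and the second neighbour of
  -- `x″` can only be `w`, since `x` and `x″` share a colour.
  few-edges⇒P3⊎C4 : ∀ {x z x″} → adj G x z ≡ true → adj G x″ z ≡ true → x ≢ x″ → G ≅ P3 ⊎ G ≅ C4
  few-edges⇒P3⊎C4 {x} {z} {x″} xz x″z x≢x″ with n G ≤? 3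
  ... | yes n≤3 = inj₁ (injective⇒≅ G P3 (lookup path) (lookup-injective path-unique) n≤3 path-adj)
    where
    path : Vec (Fin (n G)) 3
    path = x ∷ z ∷ x″ ∷ []
    path-unique : Unique path
    path-unique = (adjacent⇒≢ G xz ∷ x≢x″ ∷ []) ∷ (adjacent⇒≢ G (adj-sym G x″z) ∷ []) ∷ [] ∷ []
    path-adj : ∀ i j → adj G (lookup path i) (lookup path j) ≡ adj P3 i j
    path-adj 0F 0F = irrefl G x
    path-adj 0F 1F = xz
    path-adj 0F 2F = non-adjacent (same-colour xz x″z)
    path-adj 1F 0F = adj-sym G xz
    path-adj 1F 1F = irrefl G z
    path-adj 1F 2F = adj-sym G x″z
    path-adj 2F 0F = non-adjacent (same-colour x″z xz)
    path-adj 2F 1F = x″z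
    path-adj 2F 2F = irrefl G x″
  ... | no n≰3 = inj₂ (injective⇒≅ G C4 (lookup cycle) cycle-injective n≤4 cycle-adj)
    where
    open ≤-Reasoning
    n*p≤4p : n G * p ≤ 4 * p
    n*p≤4p = ≤-trans (≤-reflexive (≡.sym (∑-const (n G) p))) (≤-trans (∑-mono p≤deg) vol≤4p)
    n≤4 : n G ≤ 4
    n≤4 = *-cancelʳ-≤ (n G) 4 p ⦃ >-nonZero 1≤p ⦄ n*p≤4p
    deg≤p : ∀ v → deg G v ≤ p
    deg≤p v = ≮⇒≥ λ p<deg → <-irrefl refl (begin-strict
      4 * p              ≤⟨ *-monoˡ-≤ p (≰⇒> n≰3) ⟩
      n G * p            ≡⟨ ∑-const (n G) p ⟨
      ∑ {n G} (λ _ → p)  <⟨ ∑-mono-< p≤deg v p<deg ⟩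
      vol G              ≤⟨ vol≤4p ⟩
      4 * p              ∎)
    2≤deg : ∀ v → 2 ≤ deg G v
    2≤deg v = ≤-trans (two-neighbours⇒2≤deg G (adj-sym G xz) (adj-sym G x″z) x≢x″) (≤-trans (deg≤p z) (p≤deg v))
    w = proj₁ (another-neighbour G (2≤deg x) z)
    xw = proj₁ (proj₂ (another-neighbour G (2≤deg x) z))
    w≢z = proj₂ (proj₂ (another-neighbour G (2≤deg x) z))
    x″≢w : x″ ≢ w
    x″≢w x″≡w = proper x w xw (trans (same-colour xz x″z) (cong φ x″≡w))
    cycle : Vec (Fin (n G)) 4
    cycle = x ∷ z ∷ x″ ∷ w ∷ []
    cycle-injective : ∀ i j → lookup cycle i ≡ lookup cycle j → i ≡ j
    cycle-injective = lookup-injective {xs = cycle}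
      ((adjacent⇒≢ G xz ∷ x≢x″ ∷ adjacent⇒≢ G xw ∷ []) ∷
       (adjacent⇒≢ G (adj-sym G x″z) ∷ w≢z ∘ ≡.sym ∷ []) ∷ (x″≢w ∷ []) ∷ [] ∷ [])
    x″w : adj G x″ w ≡ true
    x″w with another-neighbour G (2≤deg x″) z
    ... | u , x″u , u≢z with injective⇒surjective (lookup cycle) cycle-injective n≤4 u
    ...   | 0F , refl = contradiction (same-colour x″z xz) (proper x″ x x″u)
    ...   | 1F , refl = contradiction refl u≢z
    ...   | 2F , refl = contradiction refl (proper x″ x″ x″u)
    ...   | 3F , refl = x″u
    cycle-adj : ∀ i j → adj G (lookup cycle i) (lookup cycle j) ≡ adj C4 i j
    cycle-adj 0F 0F = irrefl G x
    cycle-adj 0F 1F = xz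
    cycle-adj 0F 2F = non-adjacent (same-colour xz x″z)
    cycle-adj 0F 3F = xw
    cycle-adj 1F 0F = adj-sym G xz
    cycle-adj 1F 1F = irrefl G z
    cycle-adj 1F 2F = adj-sym G x″z
    cycle-adj 1F 3F = non-adjacent (same-colour (adj-sym G xz) (adj-sym G xw))
    cycle-adj 2F 0F = non-adjacent (same-colour x″z xz)
    cycle-adj 2F 1F = x″z
    cycle-adj 2F 2F = irrefl G x″
    cycle-adj 2F 3F = x″w
    cycle-adj 3F 0F = adj-sym G xw
    cycle-adj 3F 1F = non-adjacent (same-colour (adj-sym G xw) (adj-sym G xz))
    cycle-adj 3F 2F = adj-sym G x″w
    cycle-adj 3F 3F = irrefl G w

-- Two rows or two columns

TwoRows : ∀ {M N} → (Fin M → Fin N → Bool) → Set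
TwoRows c = ∃₂ λ α β → ∀ x → c x ≗ α ⊎ c x ≗ β

-- Along an edge from `u` to `v` the two patterns change places: all neighbours of `v` share a row,
-- and `u` is one of them. The invariant `Alternates` therefore records the row of a vertex together
-- with the common row of its neighbours.
equal-at-distance-two⇒TwoRows : ∀ {G N} {c : Fin (n G) → Fin N → Bool} → Connected G →
  (∀ {x z x″} → adj G x z ≡ true → adj G x″ z ≡ true → c x ≗ c x″) →
  ∀ {x₀ x₁} → adj G x₀ x₁ ≡ true → TwoRows c
equal-at-distance-two⇒TwoRows {G} {N} {c} conn equal {x₀} {x₁} x₀x₁ = c x₀ , c x₁ , λ x →
  [ inj₁ ∘ proj₁ , inj₂ ∘ proj₁ ]′ (Reach-preserves P closed (conn x₀ x)
    (inj₁ ((λ _ → refl) , λ x₀w → equal (adj-sym G x₀w) (adj-sym G x₀x₁))))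
  where
  Alternates : Fin (n G) → (Fin N → Bool) → (Fin N → Bool) → Set
  Alternates z α β = c z ≗ α × (∀ {w} → adj G z w ≡ true → c w ≗ β)
  P : Fin (n G) → Set
  P z = Alternates z (c x₀) (c x₁) ⊎ Alternates z (c x₁) (c x₀)
  next : ∀ {u v α β} → adj G u v ≡ true → Alternates u α β → Alternates v β α
  next uv (u≗α , nbrs) = nbrs uv , λ vw y → trans (equal (adj-sym G vw) uv y) (u≗α y)
  closed : ∀ {u v} → adj G u v ≡ true → P u → P v
  closed uv (inj₁ a) = inj₂ (next uv a)
  closed uv (inj₂ a) = inj₁ (next uv a)

-- The search runs over the finitely many subsets of the vertex set; `tabulate` turns an arbitrary
-- colouring into one of them.
bipartite⊎nonBipartite : ∀ G → (∃ λ φ → Proper G φ) ⊎ NonBipartite G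
bipartite⊎nonBipartite G with anySubset? (λ φ → all? λ x → all? λ x′ →
  (adj G x x′ ≟ᵇ true) →-dec ¬? (lookup φ x ≟ᵇ lookup φ x′))
... | yes (φ , proper) = inj₁ (lookup φ , proper)
... | no  ∄φ           = inj₂ λ φ proper → ∄φ (tabulate φ , λ x x′ xx′ eq →
        proper x x′ xx′ (trans (≡.sym (lookup∘tabulate φ x)) (trans eq (lookup∘tabulate φ x′))))

module _ {G H : Graph} {c : Fin (n G) → Fin (n H) → Bool} (M : MinCut G H c) where

  open MinCut M

  constant-rows⊎nonConstant-rows : NonBipartite H → Fin (n H) → TwoRows (flip c) ⊎ (∀ x → NonConstant (c x))
  constant-rows⊎nonConstant-rows nbH y₀ with any? (λ x → nonConstant? (c x) y₀)
  ... | yes (x , nc) = inj₂ (Mixed.nonConstant-rows M nbH y₀ nc)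
  -- All rows are constant, so every column equals column `y₀`, which serves as both patterns.
  ... | no  ∄x       = inj₁ (flip c y₀ , flip c y₀ , λ y → inj₁ λ x → constant x y)
    where
    constant : ∀ x y → c x y ≡ c x y₀
    constant x y with constant⊎nonConstant (c x) y₀
    ... | inj₁ (s , c≡s) = trans (c≡s y) (≡.sym (c≡s y₀))
    ... | inj₂ nc        = contradiction (x , nc) ∄x

  bipartite⇒TwoRows : ∀ {φ} → Proper G φ → (∀ x → NonConstant (c x)) → Fin (n G) →
                      ¬ (G ≅ P3) → ¬ (G ≅ C4) → TwoRows c
  bipartite⇒TwoRows {φ} proper nc x₀ ≇P3 ≇C4 = equal-at-distance-two⇒TwoRows {G} connG equal
    (proj₁ (proj₂ (proj₂ (mate x₀ (proj₁ (nc x₀ true))))))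
    where
    equal : ∀ {x z x″} → adj G x z ≡ true → adj G x″ z ≡ true → c x ≗ c x″
    equal {x} {z} {x″} xz x″z y with c x y ≟ᵇ c x″ y
    ... | yes eq = eq
    ... | no  c≢ = contradiction
      (few-edges⇒P3⊎C4 G p 1≤p p≤deg (distinct-rows⇒vol≤4p M φ proper nc xz x″z c≢) φ proper xz x″z
        λ { refl → c≢ refl })
      [ ≇P3 , ≇C4 ]′

  one-bipartite : ∀ {φ} → Proper G φ → NonBipartite H → ¬ (G ≅ P3) → ¬ (G ≅ C4) → Fin (n G) → Fin (n H) →
                  TwoRows c ⊎ TwoRows (flip c)
  one-bipartite proper nbH ≇P3 ≇C4 x₀ y₀ with constant-rows⊎nonConstant-rows nbH y₀
  ... | inj₁ two = inj₂ two
  ... | inj₂ nc  = inj₁ (bipartite⇒TwoRows proper nc x₀ ≇P3 ≇C4)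

-- Both coordinates change colour along an edge of the product, so `φ x xor ψ y` is constant on
-- components. Comparing `(x , y)` with `(x′ , y)` gives `φ x ≡ φ x′`.
¬both-bipartite : ∀ {G H φ ψ} → Connected (G ⊗ H) → Proper G φ → Proper H ψ →
                  ∀ {x x′} → adj G x x′ ≡ true → Fin (n H) → ⊥
¬both-bipartite {G} {H} {φ} {ψ} conn φ-proper ψ-proper {x} {x′} xx′ y =
  φ-proper x x′ xx′ (xor-cancel (ψ y) (trans (≡.sym (at x)) (trans (≡.sym (invariant (conn _ _))) (at x′))))
  where
  parity : Fin (n G * n H) → Bool
  parity u = φ (proj₁ (remQuot {n G} (n H) u)) xor ψ (proj₂ (remQuot {n G} (n H) u))
  at : ∀ x → parity (combine x y) ≡ φ x xor ψ y
  at x = cong (λ (x , y) → φ x xor ψ y) (remQuot-combine x y)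
  xor-cancel : ∀ {a b} t → a xor t ≡ b xor t → a ≡ b
  xor-cancel {true}  {true}  t     _ = refl
  xor-cancel {false} {false} t     _ = refl
  xor-cancel {true}  {false} true  ()
  xor-cancel {true}  {false} false ()
  xor-cancel {false} {true}  true  ()
  xor-cancel {false} {true}  false ()
  xor-≢ : ∀ {a b a′ b′} → a ≢ a′ → b ≢ b′ → a xor b ≡ a′ xor b′
  xor-≢ {a} {b} {a′} {b′} a≢ b≢ rewrite ¬-not a≢ | ¬-not b≢ = lemma a′ b′
    where
    lemma : ∀ a b → not a xor not b ≡ a xor b
    lemma true  b = refl
    lemma false b = not-involutive b
  invariant : ∀ {u v} → Reach (adj (G ⊗ H)) u v → parity v ≡ parity u
  invariant {u} r = Reach-preserves (λ v → parity v ≡ parity u)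
    (λ {v} {w} vw eq → let (xx′ , yy′) = ∧-true vw in
      trans (≡.sym (xor-≢ (φ-proper _ _ xx′) (ψ-proper _ _ yy′))) eq) r refl

two-rows⊎two-columns : ∀ {G H c} → MinCut G H c → Connected (G ⊗ H) →
  ¬ (G ≅ P3) → ¬ (G ≅ C4) → ¬ (H ≅ P3) → ¬ (H ≅ C4) → Fin (n G) → Fin (n H) →
  TwoRows c ⊎ TwoRows (flip c)
two-rows⊎two-columns {G} {H} M conn G≇P3 G≇C4 H≇P3 H≇C4 x₀ y₀
  with bipartite⊎nonBipartite G | bipartite⊎nonBipartite H
... | inj₁ (φ , φ-proper) | inj₁ (ψ , ψ-proper) =
  contradiction y₀ (¬both-bipartite {G} {H} conn φ-proper ψ-proper (proj₁ (proj₂ (proj₂ (MinCut.mate M x₀ y₀)))))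
... | inj₁ (φ , φ-proper) | inj₂ nbH = one-bipartite M φ-proper nbH G≇P3 G≇C4 x₀ y₀
... | inj₂ nbG | inj₁ (ψ , ψ-proper) =
  swap (one-bipartite (transpose M) ψ-proper nbG H≇P3 H≇C4 y₀ x₀)
... | inj₂ nbG | inj₂ nbH
  with constant-rows⊎nonConstant-rows M nbH y₀ | constant-rows⊎nonConstant-rows (transpose M) nbG x₀
...   | inj₁ two | _        = inj₂ two
...   | inj₂ _   | inj₁ two = inj₁ two
...   | inj₂ ncr | inj₂ ncc = contradiction ncc (both-nonBipartite M nbG nbH ncr)

-- From edge cuts to colourings

⟦∧⟧ : ∀ a b → ⟦ a ∧ b ⟧ ≡ ⟦ a ⟧ * ⟦ b ⟧
⟦∧⟧ true  b = ≡.sym (*-identityˡ ⟦ b ⟧)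
⟦∧⟧ false b = refl

-- `size` counts increasing pairs only; as there are no loops, exactly one orientation of each edge
-- is increasing.
∑∑mem≡2size : ∀ {F} (S : EdgeSet F) → ∑ (λ u → ∑ (λ v → ⟦ mem S u v ⟧)) ≡ 2 * size S
∑∑mem≡2size {F} S = begin
  ∑ (λ u → ∑ (λ v → ⟦ mem S u v ⟧))                  ≡⟨ ∑-cong (λ u → ∑-cong (orient u)) ⟩
  ∑ (λ u → ∑ (λ v → before u v + before v u))        ≡⟨ ∑-cong {n F} (λ u → ∑-+ {n F} _ _) ⟩
  ∑ (λ u → ∑ (before u) + ∑ (λ v → before v u))      ≡⟨ ∑-+ {n F} _ _ ⟩
  size S + ∑ (λ u → ∑ (λ v → before v u))            ≡⟨ cong (size S +_) (∑-comm {n F} {n F} _) ⟩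
  size S + size S                                    ≡⟨ cong (size S +_) (+-identityʳ _) ⟨
  2 * size S                                         ∎
  where
  open ≡-Reasoning
  before : Fin (n F) → Fin (n F) → ℕ
  before u v = ⟦ (toℕ u <ᵇ toℕ v) ∧ mem S u v ⟧
  compare : ∀ a b → a ≡ b ⊎ ⟦ a <ᵇ b ⟧ + ⟦ b <ᵇ a ⟧ ≡ 1
  compare zero    zero    = inj₁ refl
  compare zero    (suc b) = inj₂ refl
  compare (suc a) zero    = inj₂ refl
  compare (suc a) (suc b) = map (cong suc) (λ eq → eq) (compare a b)
  no-loops : ∀ u → mem S u u ≡ false
  no-loops u = ¬-not λ uu → contradiction (trans (≡.sym (⊆E S u u uu)) (irrefl F u)) λ ()
  before-loop : ∀ u → before u u ≡ 0
  before-loop u rewrite no-loops u = trans (⟦∧⟧ (toℕ u <ᵇ toℕ u) false) (*-zeroʳ ⟦ toℕ u <ᵇ toℕ u ⟧)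
  orient : ∀ u v → ⟦ mem S u v ⟧ ≡ before u v + before v u
  orient u v with compare (toℕ u) (toℕ v)
  ... | inj₁ eq with toℕ-injective eq
  ...   | refl = trans (cong ⟦_⟧ (no-loops u)) (≡.sym (cong₂ _+_ (before-loop u) (before-loop u)))
  orient u v | inj₂ eq = ≡.sym (begin
    before u v + before v u
      ≡⟨ cong₂ _+_ (⟦∧⟧ (toℕ u <ᵇ toℕ v) _) (trans (⟦∧⟧ (toℕ v <ᵇ toℕ u) _) (cong (λ b → ⟦ toℕ v <ᵇ toℕ u ⟧ * ⟦ b ⟧) (memSym S v u))) ⟩
    ⟦ toℕ u <ᵇ toℕ v ⟧ * ⟦ mem S u v ⟧ + ⟦ toℕ v <ᵇ toℕ u ⟧ * ⟦ mem S u v ⟧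
      ≡⟨ *-distribʳ-+ ⟦ mem S u v ⟧ ⟦ toℕ u <ᵇ toℕ v ⟧ _ ⟨
    (⟦ toℕ u <ᵇ toℕ v ⟧ + ⟦ toℕ v <ᵇ toℕ u ⟧) * ⟦ mem S u v ⟧  ≡⟨ cong (_* ⟦ mem S u v ⟧) eq ⟩
    1 * ⟦ mem S u v ⟧                                          ≡⟨ *-identityˡ _ ⟩
    ⟦ mem S u v ⟧                                              ∎)

coboundary : (F : Graph) → (Fin (n F) → Bool) → EdgeSet F
coboundary F c = record
  { mem    = λ u v → adj F u v ∧ (c u xor c v)
  ; memSym = λ u v → cong₂ _∧_ (sym F u v) (xor-comm (c u) (c v))
  ; ⊆E     = λ u v uv → proj₁ (∧-true uv)
  }

coboundary-isEdgeCut : ∀ F c {u v} → c u ≢ c v → IsEdgeCut F (coboundary F c)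
coboundary-isEdgeCut F c {u} {v} cu≢cv conn =
  cu≢cv (Reach-preserves (λ w → c u ≡ c w) (λ {w} {w′} ww′ eq → trans eq (uncut (adj F w w′) ww′)) (conn u v) refl)
  where
  uncut : ∀ {b b′} a → a ∧ not (a ∧ (b xor b′)) ≡ true → b ≡ b′
  uncut {true}  {true}  true _ = refl
  uncut {false} {false} true _ = refl

module _ (G H : Graph) where

  uncurried : (Fin (n G) → Fin (n H) → Bool) → Fin (n G * n H) → Bool
  uncurried c u = c (proj₁ (remQuot {n G} (n H) u)) (proj₂ (remQuot {n G} (n H) u))

  cut : (Fin (n G) → Fin (n H) → Bool) → EdgeSet (G ⊗ H)
  cut c = coboundary (G ⊗ H) (uncurried c)

  cost≡2size : ∀ c → cost G H c ≡ 2 * size (cut c)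
  cost≡2size c = trans (≡.sym (begin
    ∑ (λ u → ∑ (λ v → ⟦ mem (cut c) u v ⟧))
      ≡⟨ trans (∑-combine (n G) {n H} _) (∑-cong {n G} λ x → ∑-cong {n H} λ y → ∑-combine (n G) {n H} _) ⟩
    ∑ (λ x → ∑ (λ y → ∑ (λ x′ → ∑ (λ y′ → ⟦ mem (cut c) (combine {n G} {n H} x y) (combine {n G} {n H} x′ y′) ⟧))))
      ≡⟨ ∑-cong {n G} (λ x → ∑-cong {n H} λ y → ∑-cong {n G} λ x′ → ∑-cong {n H} λ y′ → entry x y x′ y′) ⟩
    ∑ (λ x → ∑ (λ y → ∑ (λ x′ → ∑ (λ y′ → ⟦ adj G x x′ ⟧ * (⟦ adj H y y′ ⟧ * ⟦ c x y xor c x′ y′ ⟧)))))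
      ≡⟨ ∑-cong {n G} (λ x → ∑-comm {n H} {n G} _) ⟩
    ∑ (λ x → ∑ (λ x′ → ∑ (λ y → ∑ (λ y′ → ⟦ adj G x x′ ⟧ * (⟦ adj H y y′ ⟧ * ⟦ c x y xor c x′ y′ ⟧)))))
      ≡⟨ ∑-cong {n G} (λ x → ∑-cong {n G} λ x′ → trans (∑-cong {n H} λ y → ∑-* {n H} ⟦ adj G x x′ ⟧ _) (∑-* {n H} ⟦ adj G x x′ ⟧ _)) ⟩
    cost G H c ∎)) (∑∑mem≡2size (cut c))
    where
    open ≡-Reasoning
    entry : ∀ x y x′ y′ → ⟦ mem (cut c) (combine x y) (combine x′ y′) ⟧ ≡
                          ⟦ adj G x x′ ⟧ * (⟦ adj H y y′ ⟧ * ⟦ c x y xor c x′ y′ ⟧)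
    entry x y x′ y′ = trans
      (cong₂ (λ (x , y) (x′ , y′) → ⟦ (adj G x x′ ∧ adj H y y′) ∧ (c x y xor c x′ y′) ⟧)
             (remQuot-combine x y) (remQuot-combine x′ y′))
      (trans (⟦∧⟧ (adj G x x′ ∧ adj H y y′) _) (trans
        (cong (_* ⟦ c x y xor c x′ y′ ⟧) (⟦∧⟧ (adj G x x′) (adj H y y′)))
        (*-assoc ⟦ adj G x x′ ⟧ ⟦ adj H y y′ ⟧ _)))

  singleton : Fin (n G) → Fin (n H) → Fin (n G) → Fin (n H) → Bool
  singleton x₀ y₀ x y = does (x ≟ x₀) ∧ does (y ≟ y₀)

  -- Union bound: a cut pair has `(x₀ , y₀)` as its first or as its second end.
  cost-singleton : ∀ x₀ y₀ → cost G H (singleton x₀ y₀) ≤ 2 * (deg G x₀ * deg H y₀)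
  cost-singleton x₀ y₀ = begin
    cost G H (singleton x₀ y₀)
      ≤⟨ ∑E-mono G (λ x x′ _ → ∑E-mono H λ y y′ _ → either (does (x ≟ x₀)) (does (x′ ≟ x₀))) ⟩
    ∑E G (λ x x′ → ∑E H (λ y y′ → δx x * δy y + δx x′ * δy y′))
      ≡⟨ ∑E-cong G (λ x x′ _ → trans (∑E-+ H _ _) (cong₂ _+_ (trans (∑E-* H (δx x) _) (cong (δx x *_) volume-y))
            (trans (∑E-* H (δx x′) _) (cong (δx x′ *_) (trans (≡.sym (∑E-flip H _)) volume-y))))) ⟩
    ∑E G (λ x x′ → δx x * deg H y₀ + δx x′ * deg H y₀)
      ≡⟨ trans (∑E-+ G _ _) (cong₂ _+_ volume-x (trans (≡.sym (∑E-flip G _)) volume-x)) ⟩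
    deg H y₀ * deg G x₀ + deg H y₀ * deg G x₀
      ≡⟨ double (deg G x₀) (deg H y₀) ⟩
    2 * (deg G x₀ * deg H y₀) ∎
    where
    open ≤-Reasoning
    δx : Fin (n G) → ℕ
    δx x = ⟦ does (x ≟ x₀) ⟧
    δy : Fin (n H) → ℕ
    δy y = ⟦ does (y ≟ y₀) ⟧
    double : ∀ a b → b * a + b * a ≡ 2 * (a * b)
    double = solve-∀
    volume-y : ∑E H (λ y _ → δy y) ≡ deg H y₀
    volume-y = trans (∑E-source H δy) (∑-δ y₀ (deg H))
    volume-x : ∑E G (λ x _ → δx x * deg H y₀) ≡ deg H y₀ * deg G x₀
    volume-x = trans (∑E-cong G λ x _ _ → *-comm (δx x) (deg H y₀))
      (trans (∑E-* G (deg H y₀) _) (cong (deg H y₀ *_) (trans (∑E-source G δx) (∑-δ x₀ (deg G)))))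
    either : ∀ a a′ {b b′} → ⟦ (a ∧ b) xor (a′ ∧ b′) ⟧ ≤ ⟦ a ⟧ * ⟦ b ⟧ + ⟦ a′ ⟧ * ⟦ b′ ⟧
    either a a′ {b} {b′} = ≤-trans (xor≤ (a ∧ b) (a′ ∧ b′)) (≤-reflexive (cong₂ _+_ (⟦∧⟧ a b) (⟦∧⟧ a′ b′)))
      where
      xor≤ : ∀ a b → ⟦ a xor b ⟧ ≤ ⟦ a ⟧ + ⟦ b ⟧
      xor≤ true  b = ≤-trans (⟦⟧≤1 (not b)) (m≤m+n 1 _)
      xor≤ false b = ≤-refl

minimiser : ∀ {N} (f : Fin N → ℕ) → Fin N → ∃ λ i → ∀ j → f i ≤ f j
minimiser {suc zero}    f _ = zero , λ { zero → ≤-refl }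
minimiser {suc (suc N)} f _ with minimiser (f ∘ suc) zero
... | i , fi≤ with ≤-total (f zero) (f (suc i))
...   | inj₁ f0≤ = zero  , λ { zero → ≤-refl ; (suc j) → ≤-trans f0≤ (fi≤ j) }
...   | inj₂ ≤f0 = suc i , λ { zero → ≤f0 ; (suc j) → fi≤ j }

Reach-map : ∀ {M N} {A : Fin M → Fin M → Bool} {B : Fin N → Fin N → Bool} (f : Fin M → Fin N) →
            (∀ {u v} → A u v ≡ true → B (f u) (f v) ≡ true) → ∀ {u v} → Reach A u v → Reach B (f u) (f v)
Reach-map f f-adj here        = here
Reach-map f f-adj (step uv r) = step (f-adj uv) (Reach-map f f-adj r)

module _ {G H : Graph} (conn : Connected (G ⊗ H)) (S : EdgeSet (G ⊗ H)) (S-min : IsMinEdgeCut (G ⊗ H) S)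
         (c : Fin (n G * n H) → Bool) (classes : ∀ u v → (c u ≡ c v) ⇔ Reach (minus (G ⊗ H) S) u v) where

  curried : Fin (n G) → Fin (n H) → Bool
  curried x y = c (combine x y)

  Isolated : Fin (n G * n H) → Set
  Isolated u = ¬ (∃ λ v → prodAdj G H u v ≡ true × c v ≡ c u)

  -- A walk from `u` to another vertex of its component would begin with an uncut edge to a
  -- neighbour of the same colour.
  isolated⇒singleton : ∀ {u} → Isolated u → ∀ v → c v ≡ c u → v ≡ u
  isolated⇒singleton {u} iso v cv≡cu with Equivalence.to (classes u v) (≡.sym cv≡cu)
  ... | here = refl
  ... | step {v = w} uw _ =
    contradiction (w , proj₁ (∧-true uw) , ≡.sym (Equivalence.from (classes u w) (step uw here))) iso

  isolated⇒Type3 : ∀ {u} → Isolated u → Type3 G H c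
  isolated⇒Type3 {u} iso = count (c u) refl
    where
    count : ∀ s → c u ≡ s → Type3 G H c
    count true  cu = inj₁ (trans (∑-cong each) (∑-δ u (λ _ → 1)))
      where
      each : ∀ v → (if c v then 1 else 0) ≡ ⟦ does (v ≟ u) ⟧ * 1
      each v with v ≟ u | c v in cv
      ... | yes _    | true  = refl
      ... | yes refl | false = contradiction (trans (≡.sym cv) cu) λ ()
      ... | no v≢u   | true  = contradiction (isolated⇒singleton iso v (trans cv (≡.sym cu))) v≢u
      ... | no _     | false = refl
    count false cu = inj₂ (trans (∑-cong each) (∑-δ u (λ _ → 1)))
      where
      each : ∀ v → (if c v then 0 else 1) ≡ ⟦ does (v ≟ u) ⟧ * 1
      each v with v ≟ u | c v in cv
      ... | yes _    | false = refl
      ... | yes refl | true  = contradiction (trans (≡.sym cv) cu) λ ()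
      ... | no v≢u   | false = contradiction (isolated⇒singleton iso v (trans cv (≡.sym cu))) v≢u
      ... | no _     | true  = refl

  -- On an empty vertex set nothing is disconnected, so the existence of a cut provides a vertex.
  vertex : Fin (n G) × Fin (n H)
  vertex = remQuot {n G} (n H) (inhabitant (n G * n H) (proj₁ S-min))
    where
    inhabitant : ∀ N {P : Fin N → Fin N → Set} → ¬ (∀ u v → P u v) → Fin N
    inhabitant zero    ¬∀ = contradiction (λ ()) ¬∀
    inhabitant (suc N) _  = zero

  -- Every edge between the two classes lies in `S`, because a surviving edge would join its ends in
  -- one component. So the coboundary of `c` is no larger than `S`, and `S` is no larger than the
  -- coboundary of a nonconstant `c′`.
  cost-minimal : ∀ c′ {x y x′ y′} → c′ x y ≢ c′ x′ y′ → cost G H curried ≤ cost G H c′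
  cost-minimal c′ {x} {y} {x′} {y′} c′≢ = begin
    cost G H curried             ≡⟨ cost≡2size G H curried ⟩
    2 * size (cut G H curried)   ≤⟨ *-monoʳ-≤ 2 (≤-trans (∑-mono λ u → ∑-mono λ v → ⟦∧⟧-mono (toℕ u <ᵇ toℕ v) (cut⊆S u v))
                                                        (proj₂ S-min (cut G H c′) separates)) ⟩
    2 * size (cut G H c′)        ≡⟨ cost≡2size G H c′ ⟨
    cost G H c′                  ∎
    where
    open ≤-Reasoning
    separates : IsEdgeCut (G ⊗ H) (cut G H c′)
    separates = coboundary-isEdgeCut (G ⊗ H) (uncurried G H c′) {combine x y} {combine x′ y′}
      λ eq → c′≢ (trans (≡.sym (at x y)) (trans eq (at x′ y′)))
      where
      at : ∀ x y → uncurried G H c′ (combine x y) ≡ c′ x y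
      at x y = cong (λ (x , y) → c′ x y) (remQuot-combine x y)
    ⟦∧⟧-mono : ∀ a {b b′} → (b ≡ true → b′ ≡ true) → ⟦ a ∧ b ⟧ ≤ ⟦ a ∧ b′ ⟧
    ⟦∧⟧-mono false          b⇒b′ = z≤n
    ⟦∧⟧-mono true {false}   b⇒b′ = z≤n
    ⟦∧⟧-mono true {true}    b⇒b′ = ≤-reflexive (cong ⟦_⟧ (≡.sym (b⇒b′ refl)))
    xor⇒≢ : ∀ {a b} → a xor b ≡ true → a ≢ b
    xor⇒≢ {true}  () refl
    xor⇒≢ {false} () refl
    cut⊆S : ∀ u v → mem (cut G H curried) u v ≡ true → mem S u v ≡ true
    cut⊆S u v uv with mem S u v in Suv | ∧-true uv
    ... | true  | _       = refl
    ... | false | uv , ≠ = contradiction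
      (trans (cong c (combine-remQuot {n G} (n H) u)) (trans
        (Equivalence.from (classes u v) (step (cong₂ (λ a s → a ∧ not s) uv Suv) here))
        (≡.sym (cong c (combine-remQuot {n G} (n H) v)))))
      (xor⇒≢ ≠)

  minCut : (∀ u → ∃ λ v → prodAdj G H u v ≡ true × c v ≡ c u) → MinCut G H curried
  minCut mate′ = record
    { p = deg G x₀ ; q = deg H y₀ ; p≤deg = proj₂ min-x ; q≤deg = proj₂ min-y
    ; 1≤p = positive G (proj₁ (proj₂ (proj₂ (mate x₀ y₀))))
    ; 1≤q = positive H (proj₁ (proj₂ (proj₂ (proj₂ (mate x₀ y₀)))))
    ; connG = λ x x′ → subst₂ (Reach (adj G)) (proj₁-combine x y₀) (proj₁-combine x′ y₀)
        (Reach-map (proj₁ ∘ remQuot {n G} (n H)) (proj₁ ∘ ∧-true) (conn (combine x y₀) (combine x′ y₀)))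
    ; connH = λ y y′ → subst₂ (Reach (adj H)) (proj₂-combine x₀ y) (proj₂-combine x₀ y′)
        (Reach-map (proj₂ ∘ remQuot {n G} (n H)) (proj₂ ∘ ∧-true) (conn (combine x₀ y) (combine x₀ y′)))
    -- The isolated vertex has minimum degree in both coordinates; the neighbour of `x₀` taken from
    -- `mate` supplies a vertex of the other colour.
    ; cost≤2pq = ≤-trans (cost-minimal (singleton G H x₀ y₀) {x₀} {y₀} {proj₁ (mate x₀ y₀)} {y₀} lone)
                         (cost-singleton G H x₀ y₀)
    ; mate = mate
    ; minimal = cost-minimal
    }
    where
    min-x = minimiser (deg G) (proj₁ vertex)
    min-y = minimiser (deg H) (proj₂ vertex)
    x₀ = proj₁ min-x
    y₀ = proj₁ min-y
    proj₁-combine : ∀ x y → proj₁ (remQuot {n G} (n H) (combine x y)) ≡ x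
    proj₁-combine x y = cong proj₁ (remQuot-combine x y)
    proj₂-combine : ∀ x y → proj₂ (remQuot {n G} (n H) (combine x y)) ≡ y
    proj₂-combine x y = cong proj₂ (remQuot-combine {n G} x y)
    mate : ∀ x y → ∃₂ λ x′ y′ → adj G x x′ ≡ true × adj H y y′ ≡ true × curried x′ y′ ≡ curried x y
    mate x y with mate′ (combine x y)
    ... | v , uv , eq with ∧-true uv
    ...   | xx′ , yy′ = proj₁ (remQuot {n G} (n H) v) , proj₂ (remQuot {n G} (n H) v) ,
      trans (cong (λ x → adj G x _) (≡.sym (proj₁-combine x y))) xx′ ,
      trans (cong (λ y → adj H y _) (≡.sym (proj₂-combine x y))) yy′ ,
      trans (cong c (combine-remQuot {n G} (n H) v)) eq
    positive : ∀ F {v w} → adj F v w ≡ true → 1 ≤ deg F v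
    positive F {v} {w} vw = ≤-trans (≤-reflexive (cong ⟦_⟧ (≡.sym vw))) (≤∑ (λ w → ⟦ adj F v w ⟧) w)
    lone : singleton G H x₀ y₀ x₀ y₀ ≢ singleton G H x₀ y₀ (proj₁ (mate x₀ y₀)) y₀
    lone eq with x₀ ≟ x₀ | y₀ ≟ y₀ | proj₁ (mate x₀ y₀) ≟ x₀
    ... | no h  | _     | _      = h refl
    ... | yes _ | no h  | _      = h refl
    ... | yes _ | yes _ | yes eq′ = adjacent⇒≢ G (proj₁ (proj₂ (proj₂ (mate x₀ y₀)))) (≡.sym eq′)
    lone () | yes _ | yes _ | no _

-- From two rows or columns to the types

select : Fin 2 → Bool → Bool → Bool
select 0F b b′ = b
select 1F b b′ = b′

-- One case analysis serves all the types: on literals each entry holds by computation or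
-- contradicts the exclusion of its pair.
table : (P : Fin 2 → Bool → Bool → Set) →
        (P 0F true true × P 1F true true) → (P 0F true false × P 1F true false) →
        (P 0F false true × P 1F false true) → (P 0F false false × P 1F false false) →
        ∀ i b b′ → P i b b′
table P (tt₀ , tt₁) (tf₀ , tf₁) (ft₀ , ft₁) (ff₀ , ff₁) = λ where
  0F true  true  → tt₀ ; 1F true  true  → tt₁
  0F true  false → tf₀ ; 1F true  false → tf₁
  0F false true  → ft₀ ; 1F false true  → ft₁
  0F false false → ff₀ ; 1F false false → ff₁

-- Membership is expressed through `does`, so that on literals both equations hold by `refl`.
Decides : ∀ {P Q : Set} → Dec P → Dec Q → Bool → Set
Decides P? Q? b = does P? ≡ b × does Q? ≡ not b

does≡⇒⇔ : ∀ {P : Set} (P? : Dec P) {b} → does P? ≡ b → (b ≡ true) ⇔ P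
does≡⇒⇔ (yes p) refl = mk⇔ (λ _ → p) (λ _ → refl)
does≡⇒⇔ (no ¬p) refl = mk⇔ (λ ()) (λ p → contradiction p ¬p)

does≡not⇒⇔ : ∀ {Q : Set} (Q? : Dec Q) {b} → does Q? ≡ not b → (b ≡ false) ⇔ Q
does≡not⇒⇔ (yes q) {false} eq = mk⇔ (λ _ → q) (λ _ → refl)
does≡not⇒⇔ (yes q) {true}  ()
does≡not⇒⇔ (no ¬q) {true}  eq = mk⇔ (λ ()) (λ q → contradiction q ¬q)
does≡not⇒⇔ (no ¬q) {false} ()

module _ (G H : Graph) (c : Fin (n G * n H) → Bool) where

  sides : ∀ {X Y : Fin (n G) → Fin (n H) → Set} (X? : ∀ x y → Dec (X x y)) (Y? : ∀ x y → Dec (Y x y))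
          (v : Fin (n G) → Fin (n H) → Bool) → (∀ x y → c (combine x y) ≡ v x y) →
          (∀ x y → Decides (X? x y) (Y? x y) (v x y)) →
          _≐_ G H c (inB G H c) X × _≐_ G H c (inW G H c) Y
  sides X? Y? v c≡v decides =
    (λ x y → does≡⇒⇔ (X? x y) (trans (proj₁ (decides x y)) (≡.sym (c≡v x y)))) ,
    (λ x y → does≡not⇒⇔ (Y? x y) (trans (proj₂ (decides x y)) (cong not (≡.sym (c≡v x y)))))

  -- A row pattern α or β per vertex of G; the label of y records the pair (α y , β y).  In type 6 the
  -- third class is W when no pair is (true , true), and B when no pair is (false , false).  Type 2 is
  -- covered as the case where the first two classes of H are empty.
  module Rows (a : Fin (n G) → Fin 2) (α β : Fin (n H) → Bool)
              (c≡ : ∀ x y → c (combine x y) ≡ select (a x) (α y) (β y)) where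

    type8 : (∃ λ y → α y ≡ true × β y ≡ true) → (∃ λ y → α y ≡ false × β y ≡ false) → Type8 G H c
    type8 (y₁ , α₁ , β₁) (y₀ , α₀ , β₀) = a , (λ y → label (α y) (β y)) ,
      (y₁ , cong₂ label α₁ β₁) , (y₀ , cong₂ label α₀ β₀) , inj₁ (sides
        (λ x y → X? (a x) (label (α y) (β y))) (λ x y → Y? (a x) (label (α y) (β y)))
        (λ x y → select (a x) (α y) (β y)) c≡ λ x y → agree (a x) (α y) (β y))
      where
      label : Bool → Bool → Fin 4
      label true  false = 0F
      label false true  = 1F
      label true  true  = 2F
      label false false = 3F
      X? = λ i (j : Fin 4) → (i ≟ 0F ×-dec j ≟ 0F) ⊎-dec (i ≟ 1F ×-dec j ≟ 1F) ⊎-dec j ≟ 2F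
      Y? = λ i (j : Fin 4) → (i ≟ 1F ×-dec j ≟ 0F) ⊎-dec (i ≟ 0F ×-dec j ≟ 1F) ⊎-dec j ≟ 3F
      agree : ∀ i b b′ → Decides (X? i (label b b′)) (Y? i (label b b′)) (select i b b′)
      agree = table _ ((refl , refl) , (refl , refl)) ((refl , refl) , (refl , refl))
                      ((refl , refl) , (refl , refl)) ((refl , refl) , (refl , refl))

    type6ᴮ : ¬ (∃ λ y → α y ≡ true × β y ≡ true) → (∃ λ y → α y ≡ false × β y ≡ false) → Type6 G H c
    type6ᴮ ∄tt (y₀ , α₀ , β₀) = a , (λ y → label (α y) (β y)) ,
      (y₀ , cong₂ label α₀ β₀) , inj₁ (sides
        (λ x y → X? (a x) (label (α y) (β y))) (λ x y → Y? (a x) (label (α y) (β y)))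
        (λ x y → select (a x) (α y) (β y)) c≡ λ x y → agree (a x) (α y) (β y) (λ eqs → ∄tt (y , eqs)))
      where
      label : Bool → Bool → Fin 3
      label true  false = 0F
      label false true  = 1F
      -- Only `(false , false)` receives this label, since `∄tt` excludes the pair `(true , true)`.
      label _     _     = 2F
      X? = λ i (j : Fin 3) → (i ≟ 0F ×-dec j ≟ 0F) ⊎-dec (i ≟ 1F ×-dec j ≟ 1F)
      Y? = λ i (j : Fin 3) → (i ≟ 1F ×-dec j ≟ 0F) ⊎-dec (i ≟ 0F ×-dec j ≟ 1F) ⊎-dec j ≟ 2F
      agree : ∀ i b b′ → ¬ (b ≡ true × b′ ≡ true) → Decides (X? i (label b b′)) (Y? i (label b b′)) (select i b b′)
      agree = table _ ((contradiction (refl , refl)) , (contradiction (refl , refl))) ((λ _ → refl , refl) , (λ _ → refl , refl))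
                      ((λ _ → refl , refl) , (λ _ → refl , refl)) ((λ _ → refl , refl) , (λ _ → refl , refl))

    type6ᵂ : (∃ λ y → α y ≡ true × β y ≡ true) → ¬ (∃ λ y → α y ≡ false × β y ≡ false) → Type6 G H c
    type6ᵂ (y₁ , α₁ , β₁) ∄ff = a , (λ y → label (α y) (β y)) ,
      (y₁ , cong₂ label α₁ β₁) , inj₂ (sides
        (λ x y → Y? (a x) (label (α y) (β y))) (λ x y → X? (a x) (label (α y) (β y)))
        (λ x y → select (a x) (α y) (β y)) c≡ λ x y → agree (a x) (α y) (β y) (λ eqs → ∄ff (y , eqs)))
      where
      label : Bool → Bool → Fin 3
      -- The two mixed labels are exchanged in comparison with `type6ᴮ`, because `W` is now the side
      -- that avoids the third class.
      label true  false = 1F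
      label false true  = 0F
      label _     _     = 2F
      X? = λ i (j : Fin 3) → (i ≟ 0F ×-dec j ≟ 0F) ⊎-dec (i ≟ 1F ×-dec j ≟ 1F)
      Y? = λ i (j : Fin 3) → (i ≟ 1F ×-dec j ≟ 0F) ⊎-dec (i ≟ 0F ×-dec j ≟ 1F) ⊎-dec j ≟ 2F
      agree : ∀ i b b′ → ¬ (b ≡ false × b′ ≡ false) → Decides (Y? i (label b b′)) (X? i (label b b′)) (select i b b′)
      agree = table _ ((λ _ → refl , refl) , (λ _ → refl , refl)) ((λ _ → refl , refl) , (λ _ → refl , refl))
                      ((λ _ → refl , refl) , (λ _ → refl , refl)) ((contradiction (refl , refl)) , (contradiction (refl , refl)))

    type4 : ¬ (∃ λ y → α y ≡ true × β y ≡ true) → ¬ (∃ λ y → α y ≡ false × β y ≡ false) → Type4 G H c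
    type4 ∄tt ∄ff = a , (λ y → label (α y) (β y)) ,
      inj₁ (sides
        (λ x y → X? (a x) (label (α y) (β y))) (λ x y → Y? (a x) (label (α y) (β y)))
        (λ x y → select (a x) (α y) (β y)) c≡ λ x y → agree (a x) (α y) (β y) (λ eqs → ∄tt (y , eqs)) (λ eqs → ∄ff (y , eqs)))
      where
      label : Bool → Bool → Fin 2
      label true  false = 0F
      label false true  = 1F
      -- A default value: neither of the two equal pairs occurs here.
      label _     _     = 0F
      X? = λ i (j : Fin 2) → (i ≟ 0F ×-dec j ≟ 0F) ⊎-dec (i ≟ 1F ×-dec j ≟ 1F)
      Y? = λ i (j : Fin 2) → (i ≟ 0F ×-dec j ≟ 1F) ⊎-dec (i ≟ 1F ×-dec j ≟ 0F)
      agree : ∀ i b b′ → ¬ (b ≡ true × b′ ≡ true) → ¬ (b ≡ false × b′ ≡ false) → Decides (X? i (label b b′)) (Y? i (label b b′)) (select i b b′)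
      agree = table _ ((λ ∄ _ → contradiction (refl , refl) ∄) , (λ ∄ _ → contradiction (refl , refl) ∄)) ((λ _ → λ _ → refl , refl) , (λ _ → λ _ → refl , refl))
                      ((λ _ → λ _ → refl , refl) , (λ _ → λ _ → refl , refl)) ((λ _ → contradiction (refl , refl)) , (λ _ → contradiction (refl , refl)))

  -- The transposed situation: one of two column patterns per vertex of `H`, with the labels on `G`.
  -- Type 1 is covered as the case where the first two classes of `G` are empty.
  module Columns (a : Fin (n H) → Fin 2) (α β : Fin (n G) → Bool)
                 (c≡ : ∀ x y → c (combine x y) ≡ select (a y) (α x) (β x)) where

    type7 : (∃ λ x → α x ≡ true × β x ≡ true) → (∃ λ x → α x ≡ false × β x ≡ false) → Type7 G H c
    type7 (x₁ , α₁ , β₁) (x₀ , α₀ , β₀) = (λ x → label (α x) (β x)) , a ,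
      (x₁ , cong₂ label α₁ β₁) , (x₀ , cong₂ label α₀ β₀) , inj₁ (sides
        (λ x y → X? (a y) (label (α x) (β x))) (λ x y → Y? (a y) (label (α x) (β x)))
        (λ x y → select (a y) (α x) (β x)) c≡ λ x y → agree (a y) (α x) (β x))
      where
      label : Bool → Bool → Fin 4
      label true  false = 0F
      label false true  = 1F
      label true  true  = 2F
      label false false = 3F
      X? = λ i (j : Fin 4) → (j ≟ 0F ×-dec i ≟ 0F) ⊎-dec (j ≟ 1F ×-dec i ≟ 1F) ⊎-dec j ≟ 2F
      Y? = λ i (j : Fin 4) → (j ≟ 0F ×-dec i ≟ 1F) ⊎-dec (j ≟ 1F ×-dec i ≟ 0F) ⊎-dec j ≟ 3F
      agree : ∀ i b b′ → Decides (X? i (label b b′)) (Y? i (label b b′)) (select i b b′)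
      agree = table _ ((refl , refl) , (refl , refl)) ((refl , refl) , (refl , refl))
                      ((refl , refl) , (refl , refl)) ((refl , refl) , (refl , refl))

    type5ᴮ : ¬ (∃ λ x → α x ≡ true × β x ≡ true) → (∃ λ x → α x ≡ false × β x ≡ false) → Type5 G H c
    type5ᴮ ∄tt (x₀ , α₀ , β₀) = (λ x → label (α x) (β x)) , a ,
      (x₀ , cong₂ label α₀ β₀) , inj₁ (sides
        (λ x y → X? (a y) (label (α x) (β x))) (λ x y → Y? (a y) (label (α x) (β x)))
        (λ x y → select (a y) (α x) (β x)) c≡ λ x y → agree (a y) (α x) (β x) (λ eqs → ∄tt (x , eqs)))
      where
      label : Bool → Bool → Fin 3
      label true  false = 0F
      label false true  = 1F
      label _     _     = 2F
      X? = λ i (j : Fin 3) → (j ≟ 0F ×-dec i ≟ 0F) ⊎-dec (j ≟ 1F ×-dec i ≟ 1F)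
      Y? = λ i (j : Fin 3) → (j ≟ 0F ×-dec i ≟ 1F) ⊎-dec (j ≟ 1F ×-dec i ≟ 0F) ⊎-dec j ≟ 2F
      agree : ∀ i b b′ → ¬ (b ≡ true × b′ ≡ true) → Decides (X? i (label b b′)) (Y? i (label b b′)) (select i b b′)
      agree = table _ ((contradiction (refl , refl)) , (contradiction (refl , refl))) ((λ _ → refl , refl) , (λ _ → refl , refl))
                      ((λ _ → refl , refl) , (λ _ → refl , refl)) ((λ _ → refl , refl) , (λ _ → refl , refl))

    type5ᵂ : (∃ λ x → α x ≡ true × β x ≡ true) → ¬ (∃ λ x → α x ≡ false × β x ≡ false) → Type5 G H c
    type5ᵂ (x₁ , α₁ , β₁) ∄ff = (λ x → label (α x) (β x)) , a ,
      (x₁ , cong₂ label α₁ β₁) , inj₂ (sides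
        (λ x y → Y? (a y) (label (α x) (β x))) (λ x y → X? (a y) (label (α x) (β x)))
        (λ x y → select (a y) (α x) (β x)) c≡ λ x y → agree (a y) (α x) (β x) (λ eqs → ∄ff (x , eqs)))
      where
      label : Bool → Bool → Fin 3
      label true  false = 1F
      label false true  = 0F
      label _     _     = 2F
      X? = λ i (j : Fin 3) → (j ≟ 0F ×-dec i ≟ 0F) ⊎-dec (j ≟ 1F ×-dec i ≟ 1F)
      Y? = λ i (j : Fin 3) → (j ≟ 0F ×-dec i ≟ 1F) ⊎-dec (j ≟ 1F ×-dec i ≟ 0F) ⊎-dec j ≟ 2F
      agree : ∀ i b b′ → ¬ (b ≡ false × b′ ≡ false) → Decides (Y? i (label b b′)) (X? i (label b b′)) (select i b b′)
      agree = table _ ((λ _ → refl , refl) , (λ _ → refl , refl)) ((λ _ → refl , refl) , (λ _ → refl , refl))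
                      ((λ _ → refl , refl) , (λ _ → refl , refl)) ((contradiction (refl , refl)) , (contradiction (refl , refl)))

    type4 : ¬ (∃ λ x → α x ≡ true × β x ≡ true) → ¬ (∃ λ x → α x ≡ false × β x ≡ false) → Type4 G H c
    type4 ∄tt ∄ff = (λ x → label (α x) (β x)) , a ,
      inj₁ (sides
        (λ x y → X? (a y) (label (α x) (β x))) (λ x y → Y? (a y) (label (α x) (β x)))
        (λ x y → select (a y) (α x) (β x)) c≡ λ x y → agree (a y) (α x) (β x) (λ eqs → ∄tt (x , eqs)) (λ eqs → ∄ff (x , eqs)))
      where
      label : Bool → Bool → Fin 2
      label true  false = 0F
      label false true  = 1F
      label _     _     = 0F
      X? = λ i (j : Fin 2) → (j ≟ 0F ×-dec i ≟ 0F) ⊎-dec (j ≟ 1F ×-dec i ≟ 1F)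
      Y? = λ i (j : Fin 2) → (j ≟ 0F ×-dec i ≟ 1F) ⊎-dec (j ≟ 1F ×-dec i ≟ 0F)
      agree : ∀ i b b′ → ¬ (b ≡ true × b′ ≡ true) → ¬ (b ≡ false × b′ ≡ false) → Decides (X? i (label b b′)) (Y? i (label b b′)) (select i b b′)
      agree = table _ ((λ ∄ _ → contradiction (refl , refl) ∄) , (λ ∄ _ → contradiction (refl , refl) ∄)) ((λ _ → λ _ → refl , refl) , (λ _ → λ _ → refl , refl))
                      ((λ _ → λ _ → refl , refl) , (λ _ → λ _ → refl , refl)) ((λ _ → contradiction (refl , refl)) , (λ _ → contradiction (refl , refl)))

  private
    both? : ∀ {N} s (α β : Fin N → Bool) → Dec (∃ λ i → α i ≡ s × β i ≡ s)
    both? s α β = any? λ i → (α i ≟ᵇ s) ×-dec (β i ≟ᵇ s)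

    selector : ∀ {N} {d α β : Fin N → Bool} → d ≗ α ⊎ d ≗ β → ∃ λ i → ∀ y → d y ≡ select i (α y) (β y)
    selector (inj₁ d≗α) = 0F , d≗α
    selector (inj₂ d≗β) = 1F , d≗β

  two-rows⇒OfSomeType : TwoRows (λ x y → c (combine x y)) → OfSomeType G H c
  two-rows⇒OfSomeType (α , β , two) with both? true α β | both? false α β
  ... | yes tt | yes ff = inj₂ (inj₂ (inj₂ (inj₂ (inj₂ (inj₂ (inj₂ (type8 tt ff)))))))
    where open Rows (proj₁ ∘ selector ∘ two) α β (proj₂ ∘ selector ∘ two)
  ... | no ∄tt | yes ff = inj₂ (inj₂ (inj₂ (inj₂ (inj₂ (inj₁ (type6ᴮ ∄tt ff))))))
    where open Rows (proj₁ ∘ selector ∘ two) α β (proj₂ ∘ selector ∘ two)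
  ... | yes tt | no ∄ff = inj₂ (inj₂ (inj₂ (inj₂ (inj₂ (inj₁ (type6ᵂ tt ∄ff))))))
    where open Rows (proj₁ ∘ selector ∘ two) α β (proj₂ ∘ selector ∘ two)
  ... | no ∄tt | no ∄ff = inj₂ (inj₂ (inj₂ (inj₁ (type4 ∄tt ∄ff))))
    where open Rows (proj₁ ∘ selector ∘ two) α β (proj₂ ∘ selector ∘ two)

  two-columns⇒OfSomeType : TwoRows (λ y x → c (combine x y)) → OfSomeType G H c
  two-columns⇒OfSomeType (α , β , two) with both? true α β | both? false α β
  ... | yes tt | yes ff = inj₂ (inj₂ (inj₂ (inj₂ (inj₂ (inj₂ (inj₁ (type7 tt ff)))))))
    where open Columns (proj₁ ∘ selector ∘ two) α β (λ x y → proj₂ (selector (two y)) x)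
  ... | no ∄tt | yes ff = inj₂ (inj₂ (inj₂ (inj₂ (inj₁ (type5ᴮ ∄tt ff)))))
    where open Columns (proj₁ ∘ selector ∘ two) α β (λ x y → proj₂ (selector (two y)) x)
  ... | yes tt | no ∄ff = inj₂ (inj₂ (inj₂ (inj₂ (inj₁ (type5ᵂ tt ∄ff)))))
    where open Columns (proj₁ ∘ selector ∘ two) α β (λ x y → proj₂ (selector (two y)) x)
  ... | no ∄tt | no ∄ff = inj₂ (inj₂ (inj₂ (inj₁ (type4 ∄tt ∄ff))))
    where open Columns (proj₁ ∘ selector ∘ two) α β (λ x y → proj₂ (selector (two y)) x)

theorem1p2 : (G H : Graph) → Connected (G ⊗ H) →
    ¬ (G ≅ P3) → ¬ (G ≅ C4) → ¬ (H ≅ P3) → ¬ (H ≅ C4) →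
    (S : EdgeSet (G ⊗ H)) → IsMinEdgeCut (G ⊗ H) S →
    -- c is the 2-colouring whose classes B (true) and W (false) are
    -- exactly the connected components of (G × H) - S
    (c : Fin' G H → Bool) →
    (∀ u v → (c u ≡ c v) ⇔ Reach (minus (G ⊗ H) S) u v) →
    OfSomeType G H c
theorem1p2 G H conn G≇P3 G≇C4 H≇P3 H≇C4 S S-min c classes
  -- The search looks for a vertex without neighbours of its own colour, which then forms a whole
  -- side of the cut. If there is none, decidability turns this into an actual neighbour for every
  -- vertex.
  with any? (λ u → ¬? (any? λ v → (prodAdj G H u v ≟ᵇ true) ×-dec (c v ≟ᵇ c u)))
... | yes (u , isolated) = inj₂ (inj₂ (inj₁ (isolated⇒Type3 conn S S-min c classes isolated)))
... | no  ∄isolated      = [ two-rows⇒OfSomeType G H c , two-columns⇒OfSomeType G H c ]′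
  (two-rows⊎two-columns (minCut conn S S-min c classes mate) conn G≇P3 G≇C4 H≇P3 H≇C4
    (proj₁ (vertex conn S S-min c classes)) (proj₂ (vertex conn S S-min c classes)))
  where
  mate : ∀ u → ∃ λ v → prodAdj G H u v ≡ true × c v ≡ c u
  mate u = decidable-stable (any? λ v → (prodAdj G H u v ≟ᵇ true) ×-dec (c v ≟ᵇ c u)) λ ∄v → ∄isolated (u , ∄v)
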